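{- There is a parameter-preserving reduction from Co-Path Packing (CPP) to Pathwidth One Vertex Explosion (POVE). Additionally, there is a parameter-preserving reduction from restricted CPP to restricted POVE. In all four problems the parameter is $k$.
   Context: Graphs are finite, undirected and simple. Vertex explosion: exploding a vertex $v$ of a graph removes $v$ and, for each former neighbor $u$ of $v$, adds a new vertex adjacent only to $u$. Exploding every vertex of a set $S$ means exploding the vertices of $S$ one after another (the order does not matter up to isomorphism). A path decomposition of $G$ is a sequence $X_1,\ldots,X_s$ of vertex sets such that every vertex lies in some $X_i$, both endpoints of every edge lie in some common $X_i$, and $X_i\cap X_j\subseteq X_l$ for all $i\le l\le j$; its width is $\max_i|X_i|-1$, and the pathwidth of $G$ is the minimum width of a path decomposition of $G$. A graph is a linear forest if every connected component is a path (a single vertex is a path). POVE: the input is a graph $G$ and an integer $k\ge 0$; the question is whether there is $S\subseteq V(G)$ with $|S|\le k$ such that exploding every vertex in $S$ results in a graph with pathwidth at most one. Restricted POVE: the input additionally contains a set $X\subseteq V(G)$, and $S$ is required to be a subset of $X$. CPP: the input is a graph $G$ and an integer $k\ge 0$; the question is whether there is $S\subseteq V(G)$ with $|S|\le k$ such that deleting the vertices in $S$ results in a linear forest. Restricted CPP: the input additionally contains a set $X\subseteq V(G)$, and $S$ is required to be a subset of $X$. A parameter-preserving reduction from a parameterized problem $P$ to a parameterized problem $Q$ is a polynomial-time algorithm that maps each instance $(I,k)$ of $P$ to an instance $(I',k')$ of $Q$ such that $k'\le k$ and $(I,k)$ is a yes-instance of $P$ if and only if $(I',k')$ is a yes-instance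 of $Q$. -}

module Defs where

open import Data.Bool.Base using (Bool; true; false)
open import Data.Digit using (toDigits)
open import Data.Empty using (⊥)
open import Data.Fin.Base using (Fin; zero; suc; toℕ)
import Data.Fin.Base as Fin
open import Data.Fin.Subset using (Subset; _⊆_; ∣_∣) renaming (_∈_ to _∈ˢ_; _∉_ to _∉ˢ_)
open import Data.Integer.Base using (ℤ; _⊖_)
import Data.Integer.Base as ℤ
open import Data.List.Base using (List; []; _∷_; _++_; [_]; length; map; concat; tabulate; fromMaybe)
open import Data.List.Extrema.Nat using (max)
open import Data.List.Membership.Propositional using (_∈_)
open import Data.List.Relation.Unary.Unique.Propositional using (Unique)
open import Data.Maybe.Base using (Maybe; just; nothing)
open import Data.Nat.Base using (ℕ; zero; suc; _≤_; _*_; _^_)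
open import Data.Nat.Properties using (1+n≢n)
open import Data.Product.Base using (Σ-syntax; ∃-syntax; _×_; _,_; proj₁)
open import Data.Refinement using (Refinement-syntax; value)
open import Data.Sum.Base using (_⊎_; inj₁; inj₂)
import Data.Sum.Base as Sum
open import Data.Vec.Base using (Vec; _∷_; replicate; zipWith; toList)
import Data.Vec.Base as Vec
open import Function.Base using (_∘_)
open import Function.Bundles using (_↔_; _⇔_; Inverse)
open import Level using (0ℓ; Lift) renaming (suc to lsuc)
open import Relation.Binary.Construct.Closure.ReflexiveTransitive using (Star)
open import Relation.Binary.Core using (Rel)
open import Relation.Binary.Definitions using (Decidable; Symmetric)
open import Relation.Binary.PropositionalEquality using (_≡_; _≢_; refl; sym)
open import Relation.Nullary using (¬_; does)
open import Relation.Unary using (Pred; Empty; ∅; _⟨⊎⟩_)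

private
  variable
    V W : Set

------------------------------------------------------------------------
-- Simple graphs

record Graph (V : Set) : Set₁ where
  infix 4 _∼_
  field
    _∼_    : Rel V 0ℓ
    ∼-sym  : Symmetric _∼_
    irrefl : ∀ {v} → ¬ (v ∼ v)

record Isomorphism (G : Graph V) (H : Graph W) : Set where
  private
    module G = Graph G
    module H = Graph H
  field
    bijection : V ↔ W
  open Inverse bijection public using (to; from)
  field
    preserves : ∀ {u v} → u G.∼ v → to u H.∼ to v
    reflects  : ∀ {u v} → to u H.∼ to v → u G.∼ v

-- Membership proofs in a refinement type are irrelevant, so the vertices
-- of an induced subgraph are the elements of P without repetition.

induced : Graph V → (P : Pred V 0ℓ) → Graph [ v ∈ V ∣ P v ]
induced G P = record
  { _∼_    = λ u v → value u ∼ value v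
  ; ∼-sym  = ∼-sym
  ; irrefl = irrefl
  }
  where open Graph G

------------------------------------------------------------------------
-- Linear forests

pathGraph : ∀ m → Graph (Fin m)
pathGraph m = record
  { _∼_    = λ i j → suc (toℕ i) ≡ toℕ j ⊎ suc (toℕ j) ≡ toℕ i
  ; ∼-sym  = Sum.swap
  ; irrefl = λ { (inj₁ p) → 1+n≢n p ; (inj₂ p) → 1+n≢n p }
  }

IsPath : Graph V → Set
IsPath G = ∃[ m ] Isomorphism (pathGraph (suc m)) G

LinearForest : Graph V → Set
LinearForest G = ∀ v → IsPath (induced G (Star _∼_ v))
  where open Graph G

------------------------------------------------------------------------
-- Pathwidth

record PathDecomposition {V : Set} (G : Graph V) : Set where
  open Graph G
  field
    s           : ℕ
    bag         : Fin s → List V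
    bag-unique  : ∀ i → Unique (bag i)
    vertex-in   : ∀ v → ∃[ i ] v ∈ bag i
    edge-in     : ∀ {u v} → u ∼ v → ∃[ i ] u ∈ bag i × v ∈ bag i
    consecutive : ∀ {i l j v} → i Fin.≤ l → l Fin.≤ j →
                  v ∈ bag i → v ∈ bag j → v ∈ bag l

  -- The graph without vertices has width -1.
  width : ℤ
  width = max 0 (tabulate (length ∘ bag)) ⊖ 1

IsPathwidth : Graph V → ℤ → Set
IsPathwidth G w =
  (Σ[ D ∈ PathDecomposition G ] width D ≡ w) ×
  (∀ (D : PathDecomposition G) → w ℤ.≤ width D)
  where open PathDecomposition

PathwidthAtMostOne : Graph V → Set
PathwidthAtMostOne G = ∃[ w ] IsPathwidth G w × w ℤ.≤ ℤ.1ℤ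

------------------------------------------------------------------------
-- Vertex explosion

-- The new vertex inj₂ u is the one attached to the former neighbour u of v.

Exploded : (G : Graph V) → V → Set
Exploded {V} G v = [ u ∈ V ∣ u ≢ v ] ⊎ [ u ∈ V ∣ v ∼ u ]
  where open Graph G

explode : (G : Graph V) (v : V) → Graph (Exploded G v)
explode {V} G v = record
  { _∼_    = adj
  ; ∼-sym  = λ {x} {y} → adj-sym x y
  ; irrefl = λ {x} → adj-irrefl x
  }
  where
  open Graph G

  adj : Rel (Exploded G v) 0ℓ
  adj (inj₁ u) (inj₁ w) = value u ∼ value w
  adj (inj₁ u) (inj₂ x) = value u ≡ value x
  adj (inj₂ x) (inj₁ u) = value x ≡ value u
  adj (inj₂ x) (inj₂ y) = ⊥

  adj-sym : ∀ x y → adj x y → adj y x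
  adj-sym (inj₁ u) (inj₁ w) = ∼-sym
  adj-sym (inj₁ u) (inj₂ x) = sym
  adj-sym (inj₂ x) (inj₁ u) = sym

  adj-irrefl : ∀ x → ¬ adj x x
  adj-irrefl (inj₁ u) = irrefl

-- ExplodeAll G S H: the graph H results from exploding the vertices of S
-- one after another, in some order.

data ExplodeAll : {V W : Set} → Graph V → Pred V 0ℓ → Graph W → Set₁ where
  done : {G : Graph V} {S : Pred V 0ℓ} → Empty S → ExplodeAll G S G
  step : {G : Graph V} {S : Pred V 0ℓ} {H : Graph W} (v : V) → S v →
         ExplodeAll (explode G v) ((S ∘ value) ⟨⊎⟩ ∅) H →
         ExplodeAll G S H

------------------------------------------------------------------------
-- Multitape Turing machines with a write-only output tape

data Symbol : Set where
  O I ♯ : Symbol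

Cell : Set
Cell = Maybe Symbol

data Move : Set where
  left stay right : Move

-- A two-way infinite tape; all cells beyond the two lists are blank, and
-- both lists start next to the head.

record Tape : Set where
  constructor tape
  field
    before : List Cell
    head   : Cell
    after  : List Cell

open Tape

load : List Symbol → Tape
load []       = tape [] nothing []
load (x ∷ xs) = tape [] (just x) (map just xs)

writeMove : Cell × Move → Tape → Tape
writeMove (c , stay)  (tape ls       _ rs)       = tape ls c rs
writeMove (c , left)  (tape []       _ rs)       = tape [] nothing (c ∷ rs)
writeMove (c , left)  (tape (l ∷ ls) _ rs)       = tape ls l (c ∷ rs)
writeMove (c , right) (tape ls       _ [])       = tape (c ∷ ls) nothing []
writeMove (c , right) (tape ls       _ (r ∷ rs)) = tape (c ∷ ls) r rs

record Action (states tapes : ℕ) : Set where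
  field
    next   : Fin states
    writes : Vec (Cell × Move) tapes
    emit   : Maybe Symbol

record Machine : Set where
  field
    states    : ℕ
    start     : Fin states
    workTapes : ℕ

  tapes : ℕ
  tapes = suc workTapes

  -- The machine halts when δ yields nothing.
  field
    δ : Fin states → Vec Cell tapes → Maybe (Action states tapes)

  Config : Set
  Config = Fin states × Vec Tape tapes

  initial : List Symbol → Config
  initial w = start , load w ∷ replicate workTapes (load [])

  infix 4 _⇓⟨_⟩_

  -- c ⇓⟨ t ⟩ w: started in c, the machine halts after exactly t steps,
  -- having written w on its output tape.

  data _⇓⟨_⟩_ : Config → ℕ → List Symbol → Set where
    halt : ∀ {q ts} → δ q (Vec.map head ts) ≡ nothing → (q , ts) ⇓⟨ 0 ⟩ []
    move : ∀ {q ts a t w} → δ q (Vec.map head ts) ≡ just a →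
           (Action.next a , zipWith writeMove (Action.writes a) ts) ⇓⟨ t ⟩ w →
           (q , ts) ⇓⟨ suc t ⟩ (fromMaybe (Action.emit a) ++ w)

------------------------------------------------------------------------
-- Parameterized problems and reductions

record ParameterizedProblem : Set₂ where
  field
    Instance  : Set₁
    encode    : Instance → List Symbol
    parameter : Instance → ℕ
    Yes       : Instance → Set₁

open ParameterizedProblem

PolynomialTime : (P Q : ParameterizedProblem) → (Instance P → Instance Q) → Set₁
PolynomialTime P Q f =
  Σ[ M ∈ Machine ] ∃[ c ] ∃[ d ] (∀ (x : Instance P) →
    ∃[ t ] t ≤ c * suc (length (encode P x)) ^ d ×
           (let open Machine M in initial (encode P x) ⇓⟨ t ⟩ encode Q (f x)))

record ParameterPreservingReduction (P Q : ParameterizedProblem) : Set₁ where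
  field
    f              : Instance P → Instance Q
    polynomialTime : PolynomialTime P Q f
    parameter-≤    : ∀ x → parameter Q (f x) ≤ parameter P x
    correct        : ∀ x → Yes P x ⇔ Yes Q (f x)

------------------------------------------------------------------------
-- Problem instances and their encodings

record FiniteGraph : Set₁ where
  field
    order : ℕ
    graph : Graph (Fin order)
  open Graph graph public
  field
    _∼?_  : Decidable _∼_

record PlainInstance : Set₁ where
  field
    G : FiniteGraph
    k : ℕ
  open FiniteGraph G public

record RestrictedInstance : Set₁ where
  field
    G : FiniteGraph
    X : Subset (FiniteGraph.order G)
    k : ℕ
  open FiniteGraph G public

bit : Bool → Symbol
bit false = O
bit true  = I

-- The rows of the adjacency matrix, each followed by a separator.

encodeGraph : FiniteGraph → List Symbol
encodeGraph G = concat (tabulate λ u → tabulate (λ v → bit (does (u ∼? v))) ++ [ ♯ ])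
  where open FiniteGraph G

encodeSubset : ∀ {n} → Subset n → List Symbol
encodeSubset X = map bit (toList X)

-- Binary, least significant digit first.

encodeℕ : ℕ → List Symbol
encodeℕ k = map digit (proj₁ (toDigits 2 k))
  where
  digit : Fin 2 → Symbol
  digit zero       = O
  digit (suc zero) = I

encodeInstance : PlainInstance → List Symbol
encodeInstance x = encodeGraph G ++ [ ♯ ] ++ encodeℕ k
  where open PlainInstance x

encodeRestricted : RestrictedInstance → List Symbol
encodeRestricted x = encodeGraph G ++ [ ♯ ] ++ encodeSubset X ++ [ ♯ ] ++ encodeℕ k
  where open RestrictedInstance x

------------------------------------------------------------------------
-- The four problems

DeletionToLinearForest : (G : FiniteGraph) → Subset (FiniteGraph.order G) → Set
DeletionToLinearForest G S = LinearForest (induced graph (_∉ˢ S))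
  where open FiniteGraph G

ExplosionToPathwidthOne : (G : FiniteGraph) → Subset (FiniteGraph.order G) → Set₁
ExplosionToPathwidthOne G S =
  Σ[ W ∈ Set ] Σ[ H ∈ Graph W ] ExplodeAll graph (_∈ˢ S) H × PathwidthAtMostOne H
  where open FiniteGraph G

CPP : ParameterizedProblem
CPP = record
  { Instance  = PlainInstance
  ; encode    = encodeInstance
  ; parameter = PlainInstance.k
  ; Yes       = λ x → let open PlainInstance x in
      Lift (lsuc 0ℓ) (∃[ S ] ∣ S ∣ ≤ k × DeletionToLinearForest G S)
  }

RestrictedCPP : ParameterizedProblem
RestrictedCPP = record
  { Instance  = RestrictedInstance
  ; encode    = encodeRestricted
  ; parameter = RestrictedInstance.k
  ; Yes       = λ x → let open RestrictedInstance x in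
      Lift (lsuc 0ℓ) (∃[ S ] S ⊆ X × ∣ S ∣ ≤ k × DeletionToLinearForest G S)
  }

POVE : ParameterizedProblem
POVE = record
  { Instance  = PlainInstance
  ; encode    = encodeInstance
  ; parameter = PlainInstance.k
  ; Yes       = λ x → let open PlainInstance x in
      ∃[ S ] ∣ S ∣ ≤ k × ExplosionToPathwidthOne G S
  }

RestrictedPOVE : ParameterizedProblem
RestrictedPOVE = record
  { Instance  = RestrictedInstance
  ; encode    = encodeRestricted
  ; parameter = RestrictedInstance.k
  ; Yes       = λ x → let open RestrictedInstance x in
      ∃[ S ] S ⊆ X × ∣ S ∣ ≤ k × ExplosionToPathwidthOne G S
  }

{-# OPTIONS --safe #-}

-- Attach one pendant vertex to every vertex of G. Exploding a pendant vertex
-- changes nothing up to isomorphism, so only explosions of original vertices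
-- matter, and exploding S leaves G − S with a pendant at every vertex, further
-- leaves, and components K₂. If G − S is a linear forest this is a caterpillar
-- forest, hence has pathwidth at most one. Conversely, in a decomposition of
-- width one every u in G − S owns a bag consisting of u and one of its leaves;
-- these bags order G − S so that no vertex lies between two adjacent ones,
-- hence G − S is a linear forest.

module Submission where

open import Defs
open Tape using (head)
open import Data.Bool.Base using (Bool; true; false)
open import Data.Empty using (⊥; ⊥-elim; ⊥-elim-irr)
open import Data.Fin.Base using (Fin; zero; suc; toℕ; fromℕ<; combine; remQuot)
import Data.Fin.Base as Fin
import Data.Fin.Properties as Fin
open import Data.Fin.Subset using (Subset; _⊆_; ∣_∣; outside) renaming (_∈_ to _∈ˢ_; _∉_ to _∉ˢ_)
open import Data.Fin.Subset.Properties using (_∈?_)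
open import Data.Integer.Base using (_⊖_)
import Data.Integer.Base as ℤ
import Data.Integer.Properties as ℤ
import Data.Irrelevant as Irr
open import Data.List.Base using
  ( List; []; _∷_; _++_; [_]; map; length; concat; tabulate; allFin; drop; reverse; _ʳ++_; fromMaybe; filter
  ; deduplicate )
open import Data.List.Extrema.Nat using (max; max≤v⁺; xs≤max)
open import Data.List.Membership.Propositional using (_∈_; lose; find)
open import Data.List.Membership.Propositional.Properties using
  (∈-++⁺ˡ; ∈-++⁺ʳ; ∈-map⁺; ∈-filter⁺; ∈-filter⁻; ∈-deduplicate⁺; ∈-tabulate⁺; ∈-allFin)
open import Data.List.Membership.Setoid.Properties using (index-injective)
open import Data.List.Properties using
  ( ++-assoc; length-map; length-++; length-tabulate; length-reverse; map-tabulate; tabulate-cong; ʳ++-defn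
  ; reverse-involutive; reverse-map )
open import Data.List.Relation.Unary.All using (All; []; _∷_)
import Data.List.Relation.Unary.All as All
import Data.List.Relation.Unary.All.Properties as All
import Data.List.Relation.Unary.AllPairs as AllPairs
open import Data.List.Relation.Unary.Any using (here; there; index) renaming (any? to anyList?)
import Data.List.Relation.Unary.Unique.DecPropositional.Properties as DecUnique
open import Data.List.Relation.Unary.Unique.Propositional using (Unique)
import Data.List.Relation.Unary.Unique.Propositional.Properties as Unique
open import Data.Maybe.Base using (Maybe; just; nothing)
open import Data.Nat.Base
import Data.Nat.Properties as ℕ
open import Data.Nat.Properties hiding (_≟_)
open import Data.Nat.Tactic.RingSolver using (solve-∀)
open import Data.Product.Base using (∃-syntax; _×_; _,_; proj₁; proj₂)
import Data.Product.Base as Product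
open import Data.Refinement using (Refinement-syntax; _,_; value; value-injective) renaming (_≟_ to refine-≟)
open import Data.Sum.Base using (_⊎_; inj₁; inj₂; [_,_]′)
import Data.Sum.Base as Sum
open import Data.Sum.Properties using (inj₁-injective; inj₂-injective; ≡-dec)
open import Data.Vec.Base using (Vec; []; _∷_; lookup; toList; zipWith)
import Data.Vec.Base as Vec
open import Data.Vec.Properties using ([]=⇒lookup; lookup⇒[]=)
open import Function.Base using (_∘_; _on_)
open import Function.Bundles using (mk↔ₛ′; mk⇔; Inverse)
open import Function.Definitions using (Injective)
open import Level using (0ℓ; lift)
open import Relation.Binary.Construct.Closure.ReflexiveTransitive using (Star; ε; _◅_; _◅◅_)
import Relation.Binary.Construct.Closure.ReflexiveTransitive as Star
open import Relation.Binary.Definitions using (Decidable; DecidableEquality; tri<; tri≈; tri>)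
open import Relation.Binary.PropositionalEquality hiding ([_])
open import Relation.Nullary using (Dec; yes; no; does; ¬_; contradiction)
open import Relation.Nullary.Decidable using (recompute; ¬?; _×-dec_; _⊎-dec_)
open import Relation.Nullary.Negation using (contradiction-irr)
import Relation.Unary as Unary
open import Relation.Unary using (Pred; ∅; _⟨⊎⟩_; Empty)

-- Every explosion changes the vertex type, so the final graph is never described explicitly. Each
-- direction instead carries a record about the current graph and the set still to be exploded
-- (`Caterpillar` forwards, `Corona` backwards) that survives a single explosion; its index type
-- `A`, the vertices of G - S, stays fixed throughout. Linear forests enter through injective
-- numberings of `A`. A linear forest gives one with consecutive numbers on adjacent vertices, while
-- a path decomposition gives one with gaps, so the way back has to rebuild the paths by walking
-- along the numbering. Since `IsPathwidth` asks for an exact minimum, the forward direction also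
-- needs a lower bound on the width. For the running time, the pendant of a vertex is numbered
-- directly after it: the rows of the new matrix are then interleavings that a machine emits in
-- order, remembering only which row it is in.

private
  variable
    V W : Set

-- Linear layouts of linear forests

record Finite (V : Set) : Set where
  infix 4 _≟_
  field
    _≟_      : DecidableEquality V
    elements : List V
    complete : ∀ v → v ∈ elements

  search : {P : Pred V 0ℓ} → Unary.Decidable P → Dec (∃[ v ] P v)
  search P? with anyList? P? elements
  ... | yes p = let v , _ , Pv = find p in yes (v , Pv)
  ... | no ¬p = no λ (v , Pv) → ¬p (lose (complete v) Pv)

module _ {P : Pred V 0ℓ} (P? : Unary.Decidable P) where

  refineList : List V → List [ v ∈ V ∣ P v ]
  refineList [] = []
  refineList (x ∷ xs) with P? x
  ... | yes p = (x , Irr.[ p ]) ∷ refineList xs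
  ... | no  _ = refineList xs

  ∈-refineList : ∀ {xs} (v : [ v ∈ V ∣ P v ]) → value v ∈ xs → v ∈ refineList xs
  ∈-refineList {x ∷ xs} v@(_ , Irr.[ p ]) (here refl) with P? x
  ... | yes _ = here (value-injective refl)
  ... | no ¬p = contradiction-irr p ¬p
  ∈-refineList {x ∷ xs} v (there v∈) with P? x
  ... | yes p = there (∈-refineList v v∈)
  ... | no  _ = ∈-refineList v v∈

  refineFinite : Finite V → Finite [ v ∈ V ∣ P v ]
  refineFinite F = record
    { _≟_      = refine-≟ _≟_
    ; elements = refineList elements
    ; complete = λ v → ∈-refineList v (complete (value v))
    }
    where open Finite F

Consecutive : ℕ → ℕ → Set
Consecutive i j = suc i ≡ j ⊎ suc j ≡ i

module Layout (G : Graph V) (F : Finite V) (_∼?_ : Decidable (Graph._∼_ G))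
  (pos : V → ℕ) (pos-injective : Injective _≡_ _≡_ pos)
  (nothingBetween : ∀ {u v w} → Graph._∼_ G u v → pos u < pos w → pos w < pos v → ⊥)
  (bound : ℕ) (pos<bound : ∀ v → pos v < bound)
  where

  open Graph G
  open Finite F

  -- Since no vertex lies between two adjacent ones, every vertex has at most one
  -- neighbour further right, and the ray from a leftmost vertex is a component.

  data Ray : V → ℕ → Set where
    end  : ∀ {x} → (∀ y → x ∼ y → ¬ pos x < pos y) → Ray x 0
    next : ∀ {x y k} → x ∼ y → pos x < pos y → Ray y k → Ray x (suc k)

  at : ∀ {x k} → Ray x k → Fin (suc k) → V
  at {x} r zero = x
  at (next _ _ r) (suc i) = at r i

  -- Each step to the right raises `pos`, which pays for the unit of fuel it uses; with no fuel left
  -- `x` would lie at or beyond `bound`.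
  ray : ∀ fuel x → bound ≤ fuel + pos x → ∃[ k ] Ray x k
  ray zero x b≤ = contradiction (pos<bound x) (≤⇒≯ b≤)
  ray (suc fuel) x b≤ with search (λ y → (x ∼? y) ×-dec (pos x <? pos y))
  ... | yes (y , x∼y , x<y) =
    let k , r = ray fuel y (≤-trans b≤ (≤-trans (≤-reflexive (sym (+-suc fuel (pos x)))) (+-monoʳ-≤ fuel x<y)))
    in suc k , next x∼y x<y r
  ... | no ¬y = 0 , end λ y x∼y x<y → ¬y (y , x∼y , x<y)

  Leftmost : V → Set
  Leftmost x = ∀ y → x ∼ y → ¬ pos y < pos x

  leftmost : ∀ fuel x → pos x ≤ fuel → ∃[ y ] Star _∼_ x y × Leftmost y
  leftmost fuel x x≤ with search (λ y → (x ∼? y) ×-dec (pos y <? pos x))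
  ... | no ¬y = x , ε , λ y x∼y y<x → ¬y (y , x∼y , y<x)
  leftmost zero x x≤ | yes (y , x∼y , y<x) = contradiction (≤-trans y<x x≤) λ ()
  leftmost (suc fuel) x x≤ | yes (y , x∼y , y<x) =
    let z , y∼*z , lz = leftmost fuel y (s≤s⁻¹ (≤-trans y<x x≤))
    in z , x∼y ◅ y∼*z , lz

  -- Of two right neighbours, the nearer one would lie between `x` and the farther one.
  right-unique : ∀ {x y z} → x ∼ y → x ∼ z → pos x < pos y → pos x < pos z → y ≡ z
  right-unique {x} {y} {z} x∼y x∼z x<y x<z with <-cmp (pos y) (pos z)
  ... | tri< y<z _ _ = ⊥-elim (nothingBetween x∼z x<y y<z)
  ... | tri≈ _ y≡z _ = pos-injective y≡z
  ... | tri> _ _ z<y = ⊥-elim (nothingBetween x∼y x<z z<y)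

  left-unique : ∀ {x y z} → x ∼ y → x ∼ z → pos y < pos x → pos z < pos x → y ≡ z
  left-unique {x} {y} {z} x∼y x∼z y<x z<x with <-cmp (pos y) (pos z)
  ... | tri< y<z _ _ = ⊥-elim (nothingBetween (∼-sym x∼y) y<z z<x)
  ... | tri≈ _ y≡z _ = pos-injective y≡z
  ... | tri> _ _ z<y = ⊥-elim (nothingBetween (∼-sym x∼z) z<y y<x)

  adjacent-cmp : ∀ {x y} → x ∼ y → pos x < pos y ⊎ pos y < pos x
  adjacent-cmp {x} {y} x∼y with <-cmp (pos x) (pos y)
  ... | tri< x<y _ _ = inj₁ x<y
  ... | tri≈ _ x≡y _ = ⊥-elim (irrefl (subst (x ∼_) (sym (pos-injective x≡y)) x∼y))
  ... | tri> _ _ y<x = inj₂ y<x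

  at-ahead : ∀ {x k} (r : Ray x k) i → pos x ≤ pos (at r i)
  at-ahead r zero = ≤-refl
  at-ahead (next _ x<y r) (suc i) = ≤-trans (<⇒≤ x<y) (at-ahead r i)

  at-later : ∀ {x y k} {x∼y : x ∼ y} {x<y : pos x < pos y} (r : Ray y k) i →
             pos x < pos (at (next x∼y x<y r) (suc i))
  at-later {x<y = x<y} r i = <-≤-trans x<y (at-ahead r i)

  at-injective : ∀ {x k} (r : Ray x k) {i j} → at r i ≡ at r j → i ≡ j
  at-injective r {zero} {zero} eq = refl
  at-injective (next e l r) {zero} {suc j} eq = contradiction (cong pos eq) (<⇒≢ (at-later {x∼y = e} {l} r j))
  at-injective (next e l r) {suc i} {zero} eq = contradiction (cong pos (sym eq)) (<⇒≢ (at-later {x∼y = e} {l} r i))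
  at-injective (next _ _ r) {suc i} {suc j} eq = cong suc (at-injective r eq)

  at-reachable : ∀ {x k} (r : Ray x k) i → Star _∼_ x (at r i)
  at-reachable r zero = ε
  at-reachable (next x∼y _ r) (suc i) = x∼y ◅ at-reachable r i

  at-successor : ∀ {x k} (r : Ray x k) {i j} → suc (toℕ i) ≡ toℕ j → at r i ∼ at r j
  at-successor (next x∼y _ r) {zero} {suc zero} eq = x∼y
  at-successor (next _ _ r) {suc i} {suc j} eq = at-successor r (suc-injective eq)

  at-preserves : ∀ {x k} (r : Ray x k) {i j} → Consecutive (toℕ i) (toℕ j) → at r i ∼ at r j
  at-preserves r = [ at-successor r , (λ eq → ∼-sym (at-successor r eq)) ]′

  -- An edge from `x` that jumps over the second vertex of the ray would have that vertex in
  -- between.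
  at-skips : ∀ {x k} (r : Ray x k) {j} → x ∼ at r j → 1 ≡ toℕ j
  at-skips r {zero} x∼x = ⊥-elim (irrefl x∼x)
  at-skips (next _ _ r) {suc zero} x∼ = refl
  at-skips (next _ x<y (next e y<z r)) {suc (suc j)} x∼ =
    ⊥-elim (nothingBetween x∼ x<y (at-later {x∼y = e} {y<z} r j))

  at-reflects : ∀ {x k} (r : Ray x k) {i j} → at r i ∼ at r j → Consecutive (toℕ i) (toℕ j)
  at-reflects r {zero} x∼ = inj₁ (at-skips r x∼)
  at-reflects r {suc i} {zero} ∼x = inj₂ (at-skips r (∼-sym ∼x))
  at-reflects (next _ _ r) {suc i} {suc j} a = Sum.map (cong suc) (cong suc) (at-reflects r a)

  -- The right neighbour of a ray vertex is the next one and the left neighbour of a later vertex is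
  -- its predecessor. A neighbour can thus leave the ray only to the left of its start, which
  -- `Leftmost` excludes afterwards.
  at-closed : ∀ {x k} (r : Ray x k) i {y} → at r i ∼ y →
              (∃[ j ] at r j ≡ y) ⊎ (x ∼ y × pos y < pos x)
  at-closed r@(end last) zero {y} x∼y =
    inj₂ (x∼y , [ (λ x<y → ⊥-elim (last y x∼y x<y)) , (λ y<x → y<x) ]′ (adjacent-cmp x∼y))
  at-closed (next x∼z x<z r) zero x∼y with adjacent-cmp x∼y
  ... | inj₁ x<y = inj₁ (suc zero , right-unique x∼z x∼y x<z x<y)
  ... | inj₂ y<x = inj₂ (x∼y , y<x)
  at-closed (next x∼z x<z r) (suc i) z∼y with at-closed r i z∼y
  ... | inj₁ (j , eq) = inj₁ (suc j , eq)
  ... | inj₂ (z∼y , y<z) = inj₁ (zero , left-unique (∼-sym x∼z) z∼y x<z y<z)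

  at-component : ∀ {x k} (r : Ray x k) → Leftmost x → ∀ i {y} → Star _∼_ (at r i) y → ∃[ j ] at r j ≡ y
  at-component r lx i ε = i , refl
  at-component r lx i (a ◅ as) with at-closed r i a
  ... | inj₁ (j , refl) = at-component r lx j as
  ... | inj₂ (x∼y , y<x) = ⊥-elim (lx _ x∼y y<x)

  linearForest : LinearForest G
  linearForest v = k , record
    { bijection = mk↔ₛ′ to from to-from (λ i → at-injective r (cong value (to-from (to i))))
    ; preserves = at-preserves r
    ; reflects  = at-reflects r
    }
    where
    lm = leftmost (pos v) v ≤-refl
    start = proj₁ lm
    v∼*start = proj₁ (proj₂ lm)
    kr = ray bound start (m≤m+n bound _)
    k = proj₁ kr
    r = proj₂ kr

    to : Fin (suc k) → [ u ∈ V ∣ Star _∼_ v u ]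
    to i = at r i , Irr.[ v∼*start ◅◅ at-reachable r i ]

    locate : ∀ u → .(Star _∼_ v u) → ∃[ i ] at r i ≡ u
    -- The reachability proof is irrelevant, so the index may not be computed from it; it is
    -- recovered by a finite search whose success is irrelevantly known.
    locate u v∼*u = recompute (Fin.any? λ i → at r i ≟ u)
      (at-component r (proj₂ (proj₂ lm)) zero (Star.reverse ∼-sym v∼*start ◅◅ v∼*u))

    from : [ u ∈ V ∣ Star _∼_ v u ] → Fin (suc k)
    from (u , Irr.[ v∼*u ]) = proj₁ (locate u v∼*u)

    to-from : ∀ u → to (from u) ≡ u
    to-from (u , Irr.[ v∼*u ]) = value-injective (proj₂ (locate u v∼*u))

-- Numbering the vertices of a linear forest

module LinearForestLayout (G : Graph V) (F : Finite V) (linear : LinearForest G) where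

  open Graph G
  open Finite F

  size : V → ℕ
  size x = suc (proj₁ (linear x))

  private module Iso x = Isomorphism (proj₂ (linear x))

  path : ∀ x → Fin (size x) → V
  path x i = value (Iso.to x i)

  path-index : ∀ x u → .(Star _∼_ x u) → ∃[ i ] path x i ≡ u
  path-index x u x∼*u = Iso.from x (u , Irr.[ x∼*u ]) ,
    cong value (Inverse.strictlyInverseˡ (Isomorphism.bijection (proj₂ (linear x))) (u , Irr.[ x∼*u ]))

  path-closed : ∀ x {i u} → path x i ∼ u → ∃[ j ] path x j ≡ u
  path-closed x {i} {u} a with Iso.to x i
  ... | w , Irr.[ x∼*w ] = path-index x u (x∼*w ◅◅ a ◅ ε)

  onPath? : ∀ x u → Dec (∃[ i ] path x i ≡ u)
  onPath? x u = Fin.any? λ i → path x i ≟ u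

  -- The paths are laid out one after another, omitting the vertices already placed.

  pos : List V → V → ℕ
  pos [] u = 0
  pos (x ∷ xs) u with onPath? x u
  ... | yes (i , _) = toℕ i
  ... | no  _       = size x + pos xs u

  bound : List V → ℕ
  bound [] = 1
  bound (x ∷ xs) = size x + bound xs

  pos<bound : ∀ xs u → pos xs u < bound xs
  pos<bound [] u = ≤-refl
  pos<bound (x ∷ xs) u with onPath? x u
  ... | yes (i , _) = <-≤-trans (Fin.toℕ<n i) (m≤m+n (size x) _)
  ... | no  _       = +-monoʳ-< (size x) (pos<bound xs u)

  onOwnPath : ∀ x → ∃[ i ] path x i ≡ x
  onOwnPath x = path-index x x ε

  ∈-tail : ∀ {x xs u} → ¬ (∃[ i ] path x i ≡ u) → u ∈ x ∷ xs → u ∈ xs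
  ∈-tail {x} off (here refl) = ⊥-elim (off (onOwnPath x))
  ∈-tail off (there u∈) = u∈

  -- A path is a whole component, so adjacent vertices are placed by the same entry of the list; the
  -- mixed cases contradict `path-closed`.
  pos-consecutive : ∀ xs {u v} → u ∈ xs → u ∼ v → Consecutive (pos xs u) (pos xs v)
  pos-consecutive (x ∷ xs) {u} {v} u∈ u∼v with onPath? x u | onPath? x v
  ... | yes (i , refl) | yes (j , refl) = Isomorphism.reflects (proj₂ (linear x)) u∼v
  ... | yes (i , refl) | no off = ⊥-elim (off (path-closed x u∼v))
  ... | no off | yes (j , refl) = ⊥-elim (off (path-closed x (∼-sym u∼v)))
  ... | no off | no _ = Sum.map shift shift (pos-consecutive xs (∈-tail off u∈) u∼v)
    where
    shift : ∀ {m n} → suc m ≡ n → suc (size x + m) ≡ size x + n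
    shift {m} eq = trans (sym (+-suc (size x) m)) (cong (size x +_) eq)

  -- Vertices on the path of `x` get numbers below `size x`, and all others get numbers from
  -- `size x` on.
  pos-injective : ∀ xs {u v} → u ∈ xs → v ∈ xs → pos xs u ≡ pos xs v → u ≡ v
  pos-injective (x ∷ xs) {u} {v} u∈ v∈ eq with onPath? x u | onPath? x v
  ... | yes (i , p) | yes (j , q) = trans (sym p) (trans (cong (path x) (Fin.toℕ-injective eq)) q)
  ... | yes (i , _) | no _ = contradiction eq (<⇒≢ (<-≤-trans (Fin.toℕ<n i) (m≤m+n (size x) _)))
  ... | no _ | yes (j , _) = contradiction (sym eq) (<⇒≢ (<-≤-trans (Fin.toℕ<n j) (m≤m+n (size x) _)))
  ... | no off | no off′ = pos-injective xs (∈-tail off u∈) (∈-tail off′ v∈) (+-cancelˡ-≡ (size x) _ _ eq)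

-- Explosions

module Explosion (G : Graph V) (F : Finite V) (_∼?_ : Decidable (Graph._∼_ G)) (v : V) where

  open Graph G
  open Finite F

  private module E = Graph (explode G v)

  explode-finite : Finite (Exploded G v)
  explode-finite = record
    { _≟_      = ≡-dec K._≟_ L._≟_
    ; elements = map inj₁ K.elements ++ map inj₂ L.elements
    ; complete = λ { (inj₁ u) → ∈-++⁺ˡ (∈-map⁺ inj₁ (K.complete u))
                   ; (inj₂ u) → ∈-++⁺ʳ (map inj₁ K.elements) (∈-map⁺ inj₂ (L.complete u)) }
    }
    where
    module K = Finite (refineFinite (λ u → ¬? (u ≟ v)) F)
    module L = Finite (refineFinite (v ∼?_) F)

  explode-∼? : Decidable E._∼_
  explode-∼? (inj₁ u) (inj₁ w) = value u ∼? value w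
  explode-∼? (inj₁ u) (inj₂ w) = value u ≟ value w
  explode-∼? (inj₂ u) (inj₁ w) = value u ≟ value w
  explode-∼? (inj₂ u) (inj₂ w) = no λ ()

-- Every core vertex a x outside S owns a private neighbour b x. Exploding
-- b x only replaces it by the new leaf at a x.

record Corona (A : Set) (E : A → A → Set) (G : Graph V) (S : Pred V 0ℓ) : Set where
  open Graph G
  field
    a b         : A → V
    a-injective : ∀ {x y} → a x ≡ a y → x ≡ y
    b-injective : ∀ {x y} → b x ≡ b y → x ≡ y
    a≢b         : ∀ x y → a x ≢ b y
    edge        : ∀ {x y} → E x y → a x ∼ a y
    own         : ∀ x → a x ∼ b x
    a∉S         : ∀ x → ¬ S (a x)

-- The graph obtained by exploding S is a caterpillar forest with spine a.

record Caterpillar {A : Set} (pos : A → ℕ) (G : Graph V) (S : Pred V 0ℓ) : Set where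
  open Graph G
  field
    a           : A → V
    a-injective : ∀ {x y} → a x ≡ a y → x ≡ y
    a∉S         : ∀ x → ¬ S (a x)
    spine       : ∀ {x y} → a x ∼ a y → Consecutive (pos x) (pos y)
    neighbour   : ∀ v → ∃[ w ] v ∼ w
    classify    : ∀ v → S v ⊎ (∃[ x ] a x ≡ v) ⊎
                        ((∀ x → a x ≢ v) × (∀ {y z} → v ∼ y → v ∼ z → y ≡ z))

module _ {G : Graph V} {S : Pred V 0ℓ} (_≟_ : DecidableEquality V) {v : V} (v∈S : S v) where

  open Graph G

  private
    module E = Graph (explode G v)
    Survivors = (S ∘ value {P = _≢ v}) ⟨⊎⟩ ∅ {A = [ u ∈ V ∣ v ∼ u ]}

  explode-corona : ∀ {A E} → Corona A E G S → Corona A E (explode G v) Survivors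
  explode-corona {A} c = record
    { a           = a′
    ; b           = λ x → b′ x (b x ≟ v)
    ; a-injective = a-injective ∘ cong value ∘ inj₁-injective
    ; b-injective = λ {x} {y} → b′-injective (b x ≟ v) (b y ≟ v)
    ; a≢b         = λ x y → a′≢b′ x y (b y ≟ v)
    ; edge        = edge
    ; own         = λ x → own′ x (b x ≟ v)
    ; a∉S         = a∉S
    }
    where
    open Corona c

    a′ : A → Exploded G v
    a′ x = inj₁ (a x , Irr.[ (λ { refl → a∉S x v∈S }) ])

    b′ : ∀ x → Dec (b x ≡ v) → Exploded G v
    b′ x (yes bx≡v) = inj₂ (a x , Irr.[ subst (_∼ a x) bx≡v (∼-sym (own x)) ])
    b′ x (no  bx≢v) = inj₁ (b x , Irr.[ bx≢v ])

    b′-injective : ∀ {x y} p q → b′ x p ≡ b′ y q → x ≡ y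
    b′-injective (yes _) (yes _) = a-injective ∘ cong value ∘ inj₂-injective
    b′-injective (no  _) (no  _) = b-injective ∘ cong value ∘ inj₁-injective
    b′-injective (yes _) (no  _) ()
    b′-injective (no  _) (yes _) ()

    a′≢b′ : ∀ x y p → a′ x ≢ b′ y p
    a′≢b′ x y (yes _) ()
    a′≢b′ x y (no  _) = a≢b x y ∘ cong value ∘ inj₁-injective

    own′ : ∀ x p → a′ x E.∼ b′ x p
    own′ x (yes _) = refl
    own′ x (no  _) = own x

  -- Adjacency on the spine is untouched. An edge to `v` is traded for an edge to a new vertex, so
  -- no vertex becomes isolated and no degree grows.
  explode-caterpillar : ∀ {A : Set} {pos : A → ℕ} → Caterpillar pos G S →
                        Caterpillar pos (explode G v) Survivors
  explode-caterpillar {A} c = record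
    { a           = a′
    ; a-injective = a-injective ∘ cong value ∘ inj₁-injective
    ; a∉S         = a∉S
    ; spine       = spine
    ; neighbour   = neighbour′
    ; classify    = classify′
    }
    where
    open Caterpillar c

    a′ : A → Exploded G v
    a′ x = inj₁ (a x , Irr.[ (λ { refl → a∉S x v∈S }) ])

    neighbour′ : ∀ u → ∃[ w ] u E.∼ w
    neighbour′ (inj₁ (u , _)) with neighbour u
    ... | w , u∼w with w ≟ v
    ...   | yes refl = inj₂ (u , Irr.[ ∼-sym u∼w ]) , refl
    ...   | no  w≢v  = inj₁ (w , Irr.[ w≢v ]) , u∼w
    neighbour′ (inj₂ (u , Irr.[ v∼u ])) = inj₁ (u , Irr.[ (λ { refl → irrefl v∼u }) ]) , refl

    unique′ : ∀ u → (∀ {y z} → value u ∼ y → value u ∼ z → y ≡ z) →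
              ∀ {y z} → inj₁ u E.∼ y → inj₁ u E.∼ z → y ≡ z
    unique′ u unique {inj₁ y} {inj₁ z} p q = cong inj₁ (value-injective (unique p q))
    unique′ u unique {inj₂ y} {inj₂ z} p q = cong inj₂ (value-injective (trans (sym p) q))
    -- A new vertex at `u` means that `v` was the only neighbour of `u`, so `u` has no surviving
    -- neighbour `y`.
    unique′ u unique {inj₁ (y , Irr.[ y≢v ])} {inj₂ (_ , Irr.[ v∼z ])} p refl =
      ⊥-elim-irr (y≢v (unique p (∼-sym v∼z)))
    unique′ u unique {inj₂ (_ , Irr.[ v∼y ])} {inj₁ (z , Irr.[ z≢v ])} refl q =
      ⊥-elim-irr (z≢v (unique q (∼-sym v∼y)))

    leaf-unique : ∀ u {y z} → inj₂ u E.∼ y → inj₂ u E.∼ z → y ≡ z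
    leaf-unique u {inj₁ y} {inj₁ z} p q = cong inj₁ (value-injective (trans (sym p) q))

    classify′ : ∀ u → Survivors u ⊎ (∃[ x ] a′ x ≡ u) ⊎
                ((∀ x → a′ x ≢ u) × (∀ {y z} → u E.∼ y → u E.∼ z → y ≡ z))
    classify′ (inj₁ u) with classify (value u)
    ... | inj₁ s = inj₁ s
    ... | inj₂ (inj₁ (x , eq)) = inj₂ (inj₁ (x , cong inj₁ (value-injective eq)))
    ... | inj₂ (inj₂ (off , unique)) =
      inj₂ (inj₂ ((λ x → off x ∘ cong value ∘ inj₁-injective) , unique′ u unique))
    classify′ (inj₂ u) = inj₂ (inj₂ ((λ x ()) , leaf-unique u))

corona-explodeAll : ∀ {A : Set} {E : A → A → Set} {G : Graph V} {S : Pred V 0ℓ} {H : Graph W} →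
                    DecidableEquality V → ExplodeAll G S H → Corona A E G S →
                    ∃[ S′ ] Corona A E H S′
corona-explodeAll _≟_ (done _) c = _ , c
corona-explodeAll _≟_ (step v v∈S e) c =
  corona-explodeAll (≡-dec (refine-≟ _≟_) (refine-≟ _≟_)) e (explode-corona _≟_ v∈S c)

length-refineList : {P : Pred V 0ℓ} (P? : Unary.Decidable P) (xs : List V) →
                    length (refineList P? xs) ≤ length xs
length-refineList P? [] = z≤n
length-refineList P? (x ∷ xs) with P? x
... | yes _ = s≤s (length-refineList P? xs)
... | no  _ = m≤n⇒m≤1+n (length-refineList P? xs)

record ExplosionResult {V : Set} {A : Set} (pos : A → ℕ) (G : Graph V) (S : Pred V 0ℓ) : Set₁ where
  field
    {Vertex}    : Set
    {result}    : Graph Vertex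
    exploded    : ExplodeAll G S result
    finite      : Finite Vertex
    {rest}      : Pred Vertex 0ℓ
    rest-empty  : Empty rest
    caterpillar : Caterpillar pos result rest

explodeAll : ∀ {A : Set} {pos : A → ℕ} n {V : Set} {G : Graph V} {S : Pred V 0ℓ} → Finite V →
             Decidable (Graph._∼_ G) → Unary.Decidable S → Caterpillar pos G S →
             (todo : List V) → length todo ≤ n → (∀ v → S v → v ∈ todo) → ExplosionResult pos G S
explodeAll n F _∼?_ S? c [] _ S⊆todo = record
  { exploded = done S-empty ; finite = F ; rest-empty = S-empty ; caterpillar = c }
  where
  S-empty : Empty _
  S-empty v v∈S with S⊆todo v v∈S
  ... | ()
explodeAll (suc n) {G = G} {S} F _∼?_ S? c (v ∷ vs) (s≤s len) S⊆todo with S? v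
... | no v∉S = explodeAll n F _∼?_ S? c vs len λ u u∈S → shrink u∈S (S⊆todo u u∈S)
  where
  shrink : ∀ {u} → S u → u ∈ v ∷ vs → u ∈ vs
  shrink u∈S (here refl) = contradiction u∈S v∉S
  shrink u∈S (there u∈)  = u∈
... | yes v∈S = record
  { exploded    = step v v∈S R.exploded
  ; finite      = R.finite
  ; rest-empty  = R.rest-empty
  ; caterpillar = R.caterpillar
  }
  where
  open Finite F
  open Explosion G F _∼?_ v

  others? = λ u → ¬? (u ≟ v)

  survivors? : Unary.Decidable ((S ∘ value) ⟨⊎⟩ ∅)
  survivors? (inj₁ u) = S? (value u)
  survivors? (inj₂ _) = no λ ()

  shrink : ∀ {u} → .(u ≢ v) → u ∈ v ∷ vs → u ∈ vs
  shrink u≢v (here refl) = ⊥-elim-irr (u≢v refl)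
  shrink u≢v (there u∈)  = u∈

  todo-complete : ∀ u → ((S ∘ value) ⟨⊎⟩ ∅) u → u ∈ map inj₁ (refineList others? vs)
  todo-complete (inj₁ u@(w , Irr.[ w≢v ])) w∈S =
    ∈-map⁺ inj₁ (∈-refineList others? u (shrink w≢v (S⊆todo w w∈S)))

  module R = ExplosionResult (explodeAll n explode-finite explode-∼? survivors?
    (explode-caterpillar _≟_ v∈S c) (map inj₁ (refineList others? vs))
    (≤-trans (≤-reflexive (length-map inj₁ (refineList others? vs)))
             (≤-trans (length-refineList others? vs) len)) todo-complete)

-- Path decompositions of caterpillar forests

module _ (m k : ℕ) where

  quotient remainder : Fin (m * k) → ℕ
  quotient p = toℕ (proj₁ (remQuot {m} k p))
  remainder p = toℕ (proj₂ (remQuot {m} k p))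

  toℕ-remQuot : ∀ (p : Fin (m * k)) → toℕ p ≡ k * quotient p + remainder p
  toℕ-remQuot p = trans (cong toℕ (sym (Fin.combine-remQuot {m} k p))) (Fin.toℕ-combine {m} _ _)

  quotient-mono : ∀ {p q} → p Fin.≤ q → quotient p ≤ quotient q
  quotient-mono {p} {q} p≤q = ≮⇒≥ λ q<p → <⇒≱
    (subst₂ Fin._<_ (Fin.combine-remQuot {m} k q) (Fin.combine-remQuot {m} k p)
      (Fin.combine-monoˡ-< (proj₂ (remQuot {m} k q)) (proj₂ (remQuot {m} k p)) q<p)) p≤q

  remainder-mono : ∀ {p q} → p Fin.≤ q → quotient p ≡ quotient q → remainder p ≤ remainder q
  remainder-mono {p} {q} p≤q eq = +-cancelˡ-≤ (k * quotient p) _ _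
    (subst₂ _≤_ (toℕ-remQuot p) (trans (toℕ-remQuot q) (cong (λ z → k * z + remainder q) (sym eq))) p≤q)

  fromRemQuot : ∀ {i j} → i < m → j < k → ∃[ p ] quotient p ≡ i × remainder p ≡ j
  fromRemQuot i<m j<k = combine (fromℕ< i<m) (fromℕ< j<k) ,
    trans (cong (toℕ ∘ proj₁) (Fin.remQuot-combine {m} _ _)) (Fin.toℕ-fromℕ< i<m) ,
    trans (cong (toℕ ∘ proj₂) (Fin.remQuot-combine {m} (fromℕ< i<m) _)) (Fin.toℕ-fromℕ< j<k)

-- Pigeonhole on the first three entries. The colour may depend on the membership proof because the
-- role of a vertex in a bag is read off from that proof.
length≤2 : ∀ {A : Set} {xs : List A} → Unique xs → (colour : ∀ {x} → x ∈ xs → Bool) →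
           (∀ {x y} (p : x ∈ xs) (q : y ∈ xs) → colour p ≡ colour q → x ≡ y) → length xs ≤ 2
length≤2 {xs = []} u c inj = z≤n
length≤2 {xs = x ∷ []} u c inj = s≤s z≤n
length≤2 {xs = x ∷ y ∷ []} u c inj = s≤s (s≤s z≤n)
length≤2 {xs = x ∷ y ∷ z ∷ xs} ((x≢y ∷ x≢z ∷ _) AllPairs.∷ (y≢z ∷ _) AllPairs.∷ _) c inj
  with c (here refl) in p | c (there (here refl)) in q | c (there (there (here refl))) in r
... | true  | true  | _     = ⊥-elim (x≢y (inj _ _ (trans p (sym q))))
... | false | false | _     = ⊥-elim (x≢y (inj _ _ (trans p (sym q))))
... | true  | false | true  = ⊥-elim (x≢z (inj _ _ (trans p (sym r))))
... | false | true  | false = ⊥-elim (x≢z (inj _ _ (trans p (sym r))))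
... | true  | false | false = ⊥-elim (y≢z (inj _ _ (trans q (sym r))))
... | false | true  | true  = ⊥-elim (y≢z (inj _ _ (trans q (sym r))))

-- Bags are indexed lexicographically by (i , j). A spine vertex at position i
-- occupies all bags (i , _) and (suc i , 0), a pendant vertex only one bag
-- (i , suc _), and the components off the spine follow at i = bound.

data Place : Set where
  span  : ℕ → Place
  point : ℕ → ℕ → Place

Occupies : Place → ℕ → ℕ → Set
Occupies (span p)    i j = i ≡ p ⊎ (i ≡ suc p × j ≡ 0)
Occupies (point p q) i j = i ≡ p × j ≡ suc q

occupies? : ∀ p i j → Dec (Occupies p i j)
occupies? (span p)    i j = (i ℕ.≟ p) ⊎-dec ((i ℕ.≟ suc p) ×-dec (j ℕ.≟ 0))
occupies? (point p q) i j = (i ℕ.≟ p) ×-dec (j ℕ.≟ suc q)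

-- In lexicographic order a span is the interval from `(x , 0)` to `(suc x , 0)`, and a point is a
-- single bag.
occupies-convex : ∀ {m k} (P : Place) {p l q : Fin (m * k)} → p Fin.≤ l → l Fin.≤ q →
                  Occupies P (quotient m k p) (remainder m k p) → Occupies P (quotient m k q) (remainder m k q) →
                  Occupies P (quotient m k l) (remainder m k l)
occupies-convex {m} {k} (point x y) {p} {l} {q} p≤l l≤q (x≡ , y≡) (x≡′ , y≡′) =
  trans (cong (quotient m k) l≡p) x≡ , trans (cong (remainder m k) l≡p) y≡
  where
  p≡q : toℕ p ≡ toℕ q
  p≡q = trans (toℕ-remQuot m k p)
       (trans (cong₂ (λ x y → k * x + y) (trans x≡ (sym x≡′)) (trans y≡ (sym y≡′)))
              (sym (toℕ-remQuot m k q)))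
  l≡p : l ≡ p
  l≡p = Fin.toℕ-injective (≤-antisym (≤-trans l≤q (≤-reflexive (sym p≡q))) p≤l)
occupies-convex {m} {k} (span x) {p} {l} {q} p≤l l≤q op oq with quotient m k l ≤? x
... | yes ql≤x = inj₁ (≤-antisym ql≤x (≤-trans (start op) (quotient-mono m k p≤l)))
  where
  start : ∀ {i j} → Occupies (span x) i j → x ≤ i
  start (inj₁ refl) = ≤-refl
  start (inj₂ (refl , _)) = n≤1+n _
... | no ql≰x = inj₂ (stop oq)
  where
  stop : Occupies (span x) (quotient m k q) (remainder m k q) → quotient m k l ≡ suc x × remainder m k l ≡ 0
  stop (inj₁ eq) = contradiction (≤-trans (quotient-mono m k l≤q) (≤-reflexive eq)) ql≰x
  stop (inj₂ (eq , r≡0)) =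
    ql≡ , n≤0⇒n≡0 (≤-trans (remainder-mono m k l≤q (trans ql≡ (sym eq))) (≤-reflexive r≡0))
    where ql≡ = ≤-antisym (≤-trans (quotient-mono m k l≤q) (≤-reflexive eq)) (≰⇒> ql≰x)

module CaterpillarDecomposition {A : Set} {pos : A → ℕ} {G : Graph V} {S : Pred V 0ℓ}
  (pos-injective : ∀ {x y} → pos x ≡ pos y → x ≡ y) (bound : ℕ) (pos<bound : ∀ x → pos x < bound)
  (F : Finite V) (S-empty : Empty S) (c : Caterpillar pos G S) where

  open Graph G
  open Finite F
  open Caterpillar c

  Spine Leaf : V → Set
  Spine w = ∃[ x ] a x ≡ w
  Leaf w = (∀ x → a x ≢ w) × (∀ {y z} → w ∼ y → w ∼ z → y ≡ z)

  class : ∀ w → Spine w ⊎ Leaf w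
  class w with classify w
  ... | inj₁ w∈S = ⊥-elim (S-empty w w∈S)
  ... | inj₂ cw  = cw

  N : ℕ
  N = length elements

  ix : V → ℕ
  ix w = toℕ (index (complete w))

  ix<N : ∀ w → ix w < N
  ix<N w = Fin.toℕ<n (index (complete w))

  ix-injective : ∀ {v w} → ix v ≡ ix w → v ≡ w
  ix-injective {v} {w} eq = index-injective (setoid V) (complete v) (complete w) (Fin.toℕ-injective eq)

  -- Two adjacent leaves form a component K₂. The minimum of their indices is symmetric, so both
  -- ends arrive at the same bag.
  leafPlace : ∀ w y → Spine y ⊎ Leaf y → Place
  leafPlace w y (inj₁ (x , _)) = point (pos x) (ix w)
  leafPlace w y (inj₂ _)       = point bound (ix w ⊓ ix y)

  placeAs : ∀ w → Spine w ⊎ Leaf w → Place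
  placeAs w (inj₁ (x , _)) = span (pos x)
  placeAs w (inj₂ _)       = let y , _ = neighbour w in leafPlace w y (class y)

  place : V → Place
  place w = placeAs w (class w)

  -- `placeAs` consults the neighbour picked by `neighbour`; a leaf has only one, so any given
  -- neighbour `y` is that one.
  placeAs-leaf : ∀ {w y cy} (ℓ : Leaf w) → w ∼ y → class y ≡ cy → placeAs w (inj₂ ℓ) ≡ leafPlace w y cy
  placeAs-leaf {w} {y} (_ , unique) w∼y refl =
    cong (λ z → leafPlace w z (class z)) (unique (proj₂ (neighbour w)) w∼y)

  -- The Boolean is a colour taken by at most one vertex of the bag `(i , j)`: `current` needs
  -- `i < bound` and `first` needs `i ≡ bound`, while `previous` lives in column 0, and `pendant`
  -- and `second` share the other columns but not a row.
  data Role (i j : ℕ) : V → Bool → Set where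
    current  : ∀ x {w} → a x ≡ w → pos x ≡ i → Role i j w false
    previous : ∀ x {w} → a x ≡ w → suc (pos x) ≡ i → j ≡ 0 → Role i j w true
    pendant  : ∀ x {w} → pos x ≡ i → suc (ix w) ≡ j → Role i j w true
    first    : ∀ {w} → i ≡ bound → suc (ix w) ≡ j → Role i j w false
    second   : ∀ {w y} → i ≡ bound → w ∼ y → Leaf y → suc (ix y) ≡ j → Role i j w true

  beforeBound : ∀ {i} x → pos x ≡ i → i ≢ bound
  beforeBound x refl = <⇒≢ (pos<bound x)

  role-unique : ∀ {i j v w c} → Role i j v c → Role i j w c → v ≡ w
  role-unique (current x refl p) (current y refl q) = cong a (pos-injective (trans p (sym q)))
  role-unique (current x _ p) (first q _) = ⊥-elim (beforeBound x p q)
  role-unique (first q _) (current x _ p) = ⊥-elim (beforeBound x p q)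
  role-unique (first _ p) (first _ q) = ix-injective (suc-injective (trans p (sym q)))
  role-unique (previous x refl p _) (previous y refl q _) = cong a (pos-injective (suc-injective (trans p (sym q))))
  role-unique (previous _ _ _ refl) (pendant _ _ ())
  role-unique (previous _ _ _ refl) (second _ _ _ ())
  role-unique (pendant _ _ ()) (previous _ _ _ refl)
  role-unique (second _ _ _ ()) (previous _ _ _ refl)
  role-unique (pendant _ _ p) (pendant _ _ q) = ix-injective (suc-injective (trans p (sym q)))
  role-unique (pendant x p _) (second q _ _ _) = ⊥-elim (beforeBound x p q)
  role-unique (second q _ _ _) (pendant x p _) = ⊥-elim (beforeBound x p q)
  -- The column names the partner of a `second` vertex, and that partner is a leaf with only one
  -- neighbour.
  role-unique (second _ v∼y ℓ p) (second _ w∼z _ q) with ix-injective (suc-injective (trans p (sym q)))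
  ... | refl = proj₂ ℓ (∼-sym v∼y) (∼-sym w∼z)

  roleAs : ∀ {i j} w cw → Occupies (placeAs w cw) i j → ∃[ b ] Role i j w b
  roleAs w (inj₁ (x , eq)) (inj₁ p) = _ , current x eq (sym p)
  roleAs w (inj₁ (x , eq)) (inj₂ (p , q)) = _ , previous x eq (sym p) q
  roleAs w (inj₂ ℓ) o with neighbour w
  ... | y , w∼y with class y
  ...   | inj₁ (x , _) = _ , pendant x (sym (proj₁ o)) (sym (proj₂ o))
  ...   | inj₂ ℓy with ⊓-sel (ix w) (ix y)
  ...     | inj₁ eq = _ , first (proj₁ o) (trans (cong suc (sym eq)) (sym (proj₂ o)))
  ...     | inj₂ eq = _ , second (proj₁ o) w∼y ℓy (trans (cong suc (sym eq)) (sym (proj₂ o)))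

  Meeting : Place → Place → Set
  Meeting P Q = ∃[ i ] ∃[ j ] i < suc bound × j < suc N × Occupies P i j × Occupies Q i j

  meeting : ∀ {w y} cw cy → class w ≡ cw → class y ≡ cy → w ∼ y → Meeting (placeAs w cw) (placeAs y cy)
  meeting (inj₁ (x , refl)) (inj₁ (x′ , refl)) _ _ w∼y with spine w∼y
  -- Consecutive spine vertices meet in column 0 of the later one's row.
  ... | inj₁ eq = pos x′ , 0 , m≤n⇒m≤1+n (pos<bound x′) , z<s , inj₂ (sym eq , refl) , inj₁ refl
  ... | inj₂ eq = pos x , 0 , m≤n⇒m≤1+n (pos<bound x) , z<s , inj₁ refl , inj₂ (sym eq , refl)
  meeting {w} (inj₂ ℓ) (inj₁ (x , refl)) _ ey w∼y rewrite placeAs-leaf ℓ w∼y ey =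
    pos x , suc (ix w) , m≤n⇒m≤1+n (pos<bound x) , s<s (ix<N w) , (refl , refl) , inj₁ refl
  meeting {_} {y} (inj₁ (x , refl)) (inj₂ ℓ) ew _ w∼y rewrite placeAs-leaf ℓ (∼-sym w∼y) ew =
    pos x , suc (ix y) , m≤n⇒m≤1+n (pos<bound x) , s<s (ix<N y) , inj₁ refl , (refl , refl)
  meeting {w} {y} (inj₂ ℓ) (inj₂ ℓ′) ew ey w∼y
    rewrite placeAs-leaf ℓ w∼y ey | placeAs-leaf ℓ′ (∼-sym w∼y) ew =
    bound , suc (ix w ⊓ ix y) , ≤-refl , s<s (≤-<-trans (m⊓n≤m _ _) (ix<N w)) ,
    (refl , refl) , (refl , cong suc (⊓-comm (ix w) (ix y)))

  Index : Set
  -- The extra row `bound` holds the K₂ components; the extra column 0 holds the spine edges.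
  Index = Fin (suc bound * suc N)

  InBag : Index → V → Set
  InBag p w = Occupies (place w) (quotient (suc bound) (suc N) p) (remainder (suc bound) (suc N) p)

  inBag? : ∀ p → Unary.Decidable (InBag p)
  inBag? p w = occupies? (place w) _ _

  bag : Index → List V
  bag p = filter (inBag? p) (deduplicate _≟_ elements)

  ∈-bag⁺ : ∀ {p w} → InBag p w → w ∈ bag p
  ∈-bag⁺ {p} = ∈-filter⁺ (inBag? p) (∈-deduplicate⁺ _≟_ (complete _))

  ∈-bag⁻ : ∀ {p w} → w ∈ bag p → InBag p w
  ∈-bag⁻ {p} w∈ = proj₂ (∈-filter⁻ (inBag? p) {xs = deduplicate _≟_ elements} w∈)

  bag-unique : ∀ p → Unique (bag p)
  bag-unique p = Unique.filter⁺ (inBag? p) (DecUnique.deduplicate-! _≟_ elements)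

  edge-in : ∀ {v w} → v ∼ w → ∃[ p ] v ∈ bag p × w ∈ bag p
  edge-in {v} {w} v∼w with meeting (class v) (class w) refl refl v∼w
  ... | i , j , i< , j< , ov , ow with fromRemQuot (suc bound) (suc N) i< j<
  ...   | p , refl , refl = p , ∈-bag⁺ {p} ov , ∈-bag⁺ {p} ow

  decomposition : PathDecomposition G
  decomposition = record
    { s           = _
    ; bag         = bag
    ; bag-unique  = bag-unique
    ; vertex-in   = λ v → let p , v∈ , _ = edge-in (proj₂ (neighbour v)) in p , v∈
    ; edge-in     = edge-in
    ; consecutive = λ {p} {l} {q} {v} p≤l l≤q v∈p v∈q → ∈-bag⁺ {l}
        (occupies-convex {suc bound} {suc N} (place v) p≤l l≤q (∈-bag⁻ {p} v∈p) (∈-bag⁻ {q} v∈q))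
    }

  bag-size : ∀ p → length (bag p) ≤ 2
  bag-size p = length≤2 (bag-unique p) (λ v∈ → proj₁ (role v∈)) same
    where
    role : ∀ {w} → w ∈ bag p → ∃[ b ] Role _ _ w b
    role {w} w∈ = roleAs w (class w) (∈-bag⁻ {p} w∈)
    same : ∀ {v w} (v∈ : v ∈ bag p) (w∈ : w ∈ bag p) → proj₁ (role v∈) ≡ proj₁ (role w∈) → v ≡ w
    same v∈ w∈ eq = role-unique (subst (Role _ _ _) eq (proj₂ (role v∈))) (proj₂ (role w∈))

  width≤1 : PathDecomposition.width decomposition ℤ.≤ ℤ.1ℤ
  width≤1 = ℤ.⊖-monoˡ-≤ 1 (max≤v⁺ z≤n (All.tabulate⁺ bag-size))

  -- No vertex is isolated, so every decomposition has a bag with both ends of an edge.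
  1≤width : V → ∀ (D : PathDecomposition G) → ℤ.1ℤ ℤ.≤ PathDecomposition.width D
  1≤width v D with neighbour v
  ... | w , v∼w with PathDecomposition.edge-in D v∼w
  ...   | i , v∈ , w∈ = ℤ.⊖-monoˡ-≤ 1 (≤-trans (two v∈ w∈)
                          (All.lookup (xs≤max 0 sizes) (∈-tabulate⁺ i)))
    where
    sizes = tabulate (length ∘ PathDecomposition.bag D)
    two : ∀ {xs} → v ∈ xs → w ∈ xs → 2 ≤ length xs
    two (here refl) (here refl) = ⊥-elim (irrefl v∼w)
    two {_ ∷ _ ∷ _} (here _) (there _) = s≤s (s≤s z≤n)
    two {_ ∷ _ ∷ _} (there _) _ = s≤s (s≤s z≤n)

  pathwidthAtMostOne : PathwidthAtMostOne G
  pathwidthAtMostOne with elements in eq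
  ... | v ∷ _ =
    ℤ.1ℤ , ((decomposition , ℤ.≤-antisym width≤1 (1≤width v decomposition)) , 1≤width v) , ℤ.≤-refl
  -- Without vertices the minimum is -1, attained by the decomposition without bags.
  ... | [] = ℤ.-1ℤ , ((empty , refl) , -1≤width) , ℤ.-≤+
    where
    -1≤width : ∀ D → ℤ.-1ℤ ℤ.≤ PathDecomposition.width {G = G} D
    -1≤width D = ℤ.⊖-monoˡ-≤ 1 (z≤n {max 0 (tabulate (length ∘ PathDecomposition.bag D))})
    noVertex : V → ⊥
    noVertex v with subst (v ∈_) eq (complete v)
    ... | ()
    empty : PathDecomposition G
    empty = record
      { s           = 0
      ; bag         = λ ()
      ; bag-unique  = λ ()
      ; vertex-in   = λ v → ⊥-elim (noVertex v)
      ; edge-in     = λ {v} → ⊥-elim (noVertex v)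
      ; consecutive = λ { {()} }
      }

-- Layouts from path decompositions of width one

⊖1≤1⇒≤2 : ∀ m → m ⊖ 1 ℤ.≤ ℤ.1ℤ → m ≤ 2
⊖1≤1⇒≤2 zero _ = z≤n
⊖1≤1⇒≤2 (suc m) (ℤ.+≤+ m≤1) = s≤s m≤1

atMostTwo : ∀ {A : Set} {xs : List A} {x y z} → length xs ≤ 2 → x ∈ xs → y ∈ xs → z ∈ xs →
            x ≢ y → z ≡ x ⊎ z ≡ y
atMostTwo _ (here refl) (here refl) _ x≢y = ⊥-elim (x≢y refl)
atMostTwo _ (here refl) _ (here refl) _ = inj₁ refl
atMostTwo _ _ (here refl) (here refl) _ = inj₂ refl
atMostTwo {xs = _ ∷ _ ∷ []} _ (there (here refl)) (there (here refl)) _ x≢y = ⊥-elim (x≢y refl)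
atMostTwo {xs = _ ∷ _ ∷ []} _ (there (here refl)) _ (there (here refl)) _ = inj₁ refl
atMostTwo {xs = _ ∷ _ ∷ []} _ _ (there (here refl)) (there (here refl)) _ = inj₂ refl
atMostTwo {xs = _ ∷ _ ∷ _ ∷ _} (s≤s (s≤s ())) _ _ _ _

module CoronaLayout {A : Set} {E : A → A → Set} {H : Graph W} {S : Pred W 0ℓ}
  (c : Corona A E H S) (D : PathDecomposition H) (thin : PathDecomposition.width D ℤ.≤ ℤ.1ℤ) where

  open Corona c
  open PathDecomposition D

  bag-size : ∀ i → length (bag i) ≤ 2
  bag-size i = ≤-trans (All.lookup (xs≤max 0 (tabulate (length ∘ bag))) (∈-tabulate⁺ i))
                       (⊖1≤1⇒≤2 (max 0 (tabulate (length ∘ bag))) thin)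

  private
    home : A → Fin s
    home x = proj₁ (edge-in (own x))

    a-home : ∀ x → a x ∈ bag (home x)
    a-home x = proj₁ (proj₂ (edge-in (own x)))

    b-home : ∀ x → b x ∈ bag (home x)
    b-home x = proj₂ (proj₂ (edge-in (own x)))

  pos : A → ℕ
  pos = toℕ ∘ home

  -- A bag with at most two vertices that holds `a y` and `b y` is full, and `b y` is never of the
  -- form `a x`.
  a-onlyHome : ∀ {x y} → a x ∈ bag (home y) → x ≡ y
  a-onlyHome {x} {y} x∈ with atMostTwo (bag-size (home y)) (a-home y) (b-home y) x∈ (a≢b y y)
  ... | inj₁ eq = a-injective eq
  ... | inj₂ eq = ⊥-elim (a≢b x y eq)

  pos-injective : ∀ {x y} → pos x ≡ pos y → x ≡ y
  pos-injective {x} {y} eq = a-onlyHome (subst (λ i → a x ∈ bag i) (Fin.toℕ-injective eq) (a-home x))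

  -- The bag of w separates the bags of u and v but contains neither a u nor
  -- a v, so no bag can cover the edge.

  nothingBetween : ∀ {u v w} → E u v → pos u < pos w → pos w < pos v → ⊥
  nothingBetween {u} {v} {w} uv u<w w<v with edge-in (edge uv)
  ... | i , u∈ , v∈ with ≤-total (toℕ i) (pos w)
  ...   | inj₁ i≤w = <⇒≢ w<v (cong pos (sym (a-onlyHome (consecutive i≤w (<⇒≤ w<v) v∈ (a-home v)))))
  ...   | inj₂ w≤i = <⇒≢ u<w (cong pos (a-onlyHome (consecutive (<⇒≤ u<w) w≤i (a-home u) u∈)))

-- The graph with pendant vertices and its vertex subsets

finFinite : ∀ n → Finite (Fin n)
finFinite n = record { _≟_ = Fin._≟_ ; elements = allFin n ; complete = ∈-allFin }

-- The indices are `2u` and `2u + 1`, so that each matrix entry expands in place into two and each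
-- row into two consecutive rows.
main pend : ∀ {n} → Fin n → Fin (n * 2)
main u = combine u zero
pend u = combine u (suc zero)

data Split {n} : Fin (n * 2) → Set where
  isMain : ∀ (u : Fin n) → Split (main u)
  isPend : ∀ (u : Fin n) → Split (pend u)

split : ∀ {n} i → Split {n} i
split {n} i = subst (Split {n}) (Fin.combine-remQuot {n} 2 i) (splitPair (remQuot {n} 2 i))
  where
  splitPair : ∀ p → Split {n} (combine (proj₁ p) (proj₂ p))
  splitPair (u , zero)     = isMain u
  splitPair (u , suc zero) = isPend u

main-injective : ∀ {n} {u v : Fin n} → main u ≡ main v → u ≡ v
main-injective {u = u} {v} = Fin.combine-injectiveˡ u zero v zero

pend-injective : ∀ {n} {u v : Fin n} → pend u ≡ pend v → u ≡ v
pend-injective {u = u} {v} = Fin.combine-injectiveˡ u (suc zero) v (suc zero)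

main≢pend : ∀ {n} (u v : Fin n) → main u ≢ pend v
main≢pend u v eq with Fin.combine-injectiveʳ u zero v (suc zero) eq
... | ()

double : ∀ {n} → Subset n → Subset (n * 2)
double []      = []
double (x ∷ X) = x ∷ outside ∷ double X

-- Pendants of a solution are dropped rather than replaced by the vertices they hang from: after
-- exploding a pendant, its vertex still has a private leaf.
halve : ∀ n → Subset (n * 2) → Subset n
halve zero    []          = []
halve (suc n) (x ∷ _ ∷ X) = x ∷ halve n X

lookup-double-main : ∀ {n} (X : Subset n) (u : Fin n) → lookup (double X) (main u) ≡ lookup X u
lookup-double-main (x ∷ X) zero    = refl
lookup-double-main (x ∷ X) (suc u) = lookup-double-main X u

lookup-double-pend : ∀ {n} (X : Subset n) (u : Fin n) → lookup (double X) (pend u) ≡ outside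
lookup-double-pend (x ∷ X) zero    = refl
lookup-double-pend (x ∷ X) (suc u) = lookup-double-pend X u

lookup-halve : ∀ {n} (X : Subset (n * 2)) (u : Fin n) → lookup (halve n X) u ≡ lookup X (main u)
lookup-halve {suc n} (x ∷ _ ∷ X) zero    = refl
lookup-halve {suc n} (x ∷ _ ∷ X) (suc u) = lookup-halve X u

module _ {n : ℕ} {X : Subset n} where

  ∈-double⁺ : ∀ {u : Fin n} → u ∈ˢ X → main u ∈ˢ double X
  ∈-double⁺ {u} u∈ = lookup⇒[]= _ _ (trans (lookup-double-main X u) ([]=⇒lookup u∈))

  ∈-double⁻ : ∀ {u : Fin n} → main u ∈ˢ double X → u ∈ˢ X
  ∈-double⁻ {u} u∈ = lookup⇒[]= _ _ (trans (sym (lookup-double-main X u)) ([]=⇒lookup u∈))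

  pend∉double : ∀ {u : Fin n} → pend u ∉ˢ double X
  pend∉double {u} u∈ with trans (sym (lookup-double-pend X u)) ([]=⇒lookup u∈)
  ... | ()

module _ {n : ℕ} {X : Subset (n * 2)} where

  ∈-halve⁺ : ∀ {u : Fin n} → main u ∈ˢ X → u ∈ˢ halve n X
  ∈-halve⁺ {u} u∈ = lookup⇒[]= _ _ (trans (lookup-halve X u) ([]=⇒lookup u∈))

  ∈-halve⁻ : ∀ {u : Fin n} → u ∈ˢ halve n X → main u ∈ˢ X
  ∈-halve⁻ {u} u∈ = lookup⇒[]= _ _ (trans (sym (lookup-halve X u)) ([]=⇒lookup u∈))

double-⊆ : ∀ {n} {S X : Subset n} → S ⊆ X → double S ⊆ double X
double-⊆ {n} S⊆X {i} i∈ with split {n} i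
... | isMain u = ∈-double⁺ (S⊆X (∈-double⁻ i∈))
... | isPend u = ⊥-elim (pend∉double i∈)

halve-⊆ : ∀ {n} {S : Subset (n * 2)} {X : Subset n} → S ⊆ double X → halve n S ⊆ X
halve-⊆ {n} {S} S⊆X u∈ = ∈-double⁻ (S⊆X (∈-halve⁻ {n} {S} u∈))

∣double∣ : ∀ {n} (X : Subset n) → ∣ double X ∣ ≡ ∣ X ∣
∣double∣ []          = refl
∣double∣ (true ∷ X)  = cong suc (∣double∣ X)
∣double∣ (false ∷ X) = ∣double∣ X

∣halve∣≤ : ∀ {n} (X : Subset (n * 2)) → ∣ halve n X ∣ ≤ ∣ X ∣
∣halve∣≤ {zero}  []                  = z≤n
∣halve∣≤ {suc n} (true ∷ true ∷ X)   = s≤s (m≤n⇒m≤1+n (∣halve∣≤ {n} X))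
∣halve∣≤ {suc n} (true ∷ false ∷ X)  = s≤s (∣halve∣≤ {n} X)
∣halve∣≤ {suc n} (false ∷ true ∷ X)  = m≤n⇒m≤1+n (∣halve∣≤ {n} X)
∣halve∣≤ {suc n} (false ∷ false ∷ X) = ∣halve∣≤ {n} X

module Pendants (G : FiniteGraph) where

  open FiniteGraph G renaming (order to n)

  PendantAdjacent : Fin n × Fin 2 → Fin n × Fin 2 → Set
  PendantAdjacent (u , zero)     (v , zero)     = u ∼ v
  PendantAdjacent (u , zero)     (v , suc zero) = u ≡ v
  PendantAdjacent (u , suc zero) (v , zero)     = u ≡ v
  PendantAdjacent (u , suc zero) (v , suc zero) = ⊥

  pendantAdjacent? : ∀ x y → Dec (PendantAdjacent x y)
  pendantAdjacent? (u , zero)     (v , zero)     = u ∼? v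
  pendantAdjacent? (u , zero)     (v , suc zero) = u Fin.≟ v
  pendantAdjacent? (u , suc zero) (v , zero)     = u Fin.≟ v
  pendantAdjacent? (u , suc zero) (v , suc zero) = no λ ()

  pendantAdjacent-sym : ∀ x y → PendantAdjacent x y → PendantAdjacent y x
  pendantAdjacent-sym (u , zero)     (v , zero)     = ∼-sym
  pendantAdjacent-sym (u , zero)     (v , suc zero) = sym
  pendantAdjacent-sym (u , suc zero) (v , zero)     = sym
  pendantAdjacent-sym (u , suc zero) (v , suc zero) = λ ()

  pendantAdjacent-irrefl : ∀ x → ¬ PendantAdjacent x x
  pendantAdjacent-irrefl (u , zero)     = irrefl
  pendantAdjacent-irrefl (u , suc zero) = λ ()

  withPendants : FiniteGraph
  withPendants = record
    { order = n * 2
    ; graph = record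
      { _∼_    = PendantAdjacent on remQuot {n} 2
      ; ∼-sym  = λ {i} {j} → pendantAdjacent-sym (remQuot {n} 2 i) (remQuot {n} 2 j)
      ; irrefl = λ {i} → pendantAdjacent-irrefl (remQuot {n} 2 i)
      }
    ; _∼?_  = λ i j → pendantAdjacent? (remQuot {n} 2 i) (remQuot {n} 2 j)
    }

  private module P = FiniteGraph withPendants

  module _ {u v : Fin n} where

    rq : ∀ {k l} → PendantAdjacent (u , k) (v , l) → combine u k P.∼ combine v l
    rq {k} {l} = subst₂ PendantAdjacent (sym (Fin.remQuot-combine u k)) (sym (Fin.remQuot-combine v l))

    qr : ∀ {k l} → combine u k P.∼ combine v l → PendantAdjacent (u , k) (v , l)
    qr {k} {l} = subst₂ PendantAdjacent (Fin.remQuot-combine u k) (Fin.remQuot-combine v l)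

  module _ (S : Subset n) where

    Rest : Set
    Rest = [ u ∈ Fin n ∣ u ∉ˢ S ]

    rest : Graph Rest
    rest = induced graph (_∉ˢ S)

    rest-finite : Finite Rest
    rest-finite = refineFinite (λ u → ¬? (u ∈? S)) (finFinite n)

    rest-∼? : Decidable (Graph._∼_ rest)
    rest-∼? u v = value u ∼? value v

    rest∉ : ∀ (u : Rest) → value u ∉ˢ S
    rest∉ (u , Irr.[ u∉ ]) u∈ = ⊥-elim-irr (u∉ u∈)

  caterpillar : ∀ {S : Subset n} {pos : Rest S → ℕ} →
                (∀ {u v} → Graph._∼_ (rest S) u v → Consecutive (pos u) (pos v)) →
                Caterpillar pos P.graph (_∈ˢ double S)
  caterpillar {S} consecutive = record
    { a           = main ∘ value
    ; a-injective = value-injective ∘ main-injective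
    ; a∉S         = λ u → rest∉ S u ∘ ∈-double⁻
    ; spine       = consecutive ∘ qr
    ; neighbour   = neighbour
    ; classify    = classify
    }
    where
    neighbour : ∀ i → ∃[ j ] i P.∼ j
    neighbour i with split {n} i
    ... | isMain u = pend u , rq refl
    ... | isPend u = main u , rq refl

    unique : ∀ (u : Fin n) {i j} → pend u P.∼ i → pend u P.∼ j → i ≡ j
    unique u {i} {j} ui uj with split {n} i | split {n} j
    ... | isMain v | isMain w = cong main (trans (sym (qr ui)) (qr uj))
    ... | isMain _ | isPend _ = ⊥-elim (qr uj)
    ... | isPend _ | _        = ⊥-elim (qr ui)

    classify : ∀ i → i ∈ˢ double S ⊎ (∃[ u ] main (value {P = _∉ˢ S} u) ≡ i) ⊎
               ((∀ u → main (value {P = _∉ˢ S} u) ≢ i) × (∀ {j k} → i P.∼ j → i P.∼ k → j ≡ k))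
    classify i with split {n} i
    ... | isPend u = inj₂ (inj₂ ((λ v → main≢pend (value v) u) , unique u))
    ... | isMain u with u ∈? S
    ...   | yes u∈S = inj₁ (∈-double⁺ u∈S)
    ...   | no  u∉S = inj₂ (inj₁ ((u , Irr.[ u∉S ]) , refl))

  corona : (S : Subset (n * 2)) →
           Corona (Rest (halve n S)) (Graph._∼_ (rest (halve n S))) P.graph (_∈ˢ S)
  corona S = record
    { a           = main ∘ value
    ; b           = pend ∘ value
    ; a-injective = value-injective ∘ main-injective
    ; b-injective = value-injective ∘ pend-injective
    ; a≢b         = λ u v → main≢pend (value u) (value v)
    ; edge        = rq
    ; own         = λ _ → rq refl
    ; a∉S         = λ u → rest∉ (halve n S) u ∘ ∈-halve⁺ {n} {S}
    }

  deletion⇒explosion : ∀ S → DeletionToLinearForest G S → ExplosionToPathwidthOne withPendants (double S)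
  deletion⇒explosion S linear = Vertex , result , exploded ,
    CaterpillarDecomposition.pathwidthAtMostOne
      (pos-injective elements (complete _) (complete _)) (bound elements) (pos<bound elements)
      finite rest-empty caterpillar′
    where
    open LinearForestLayout (rest S) (rest-finite S) linear
    open Finite (rest-finite S)
    open ExplosionResult (explodeAll (n * 2) (finFinite (n * 2)) P._∼?_ (_∈? double S)
      (caterpillar (λ {u} → pos-consecutive elements (complete u)))
      (allFin (n * 2)) (≤-reflexive (length-tabulate _)) (λ i _ → ∈-allFin i))
      renaming (caterpillar to caterpillar′)

  explosion⇒deletion : ∀ S → ExplosionToPathwidthOne withPendants S → DeletionToLinearForest G (halve n S)
  explosion⇒deletion S (_ , H , exploded , _ , ((D , refl) , _) , thin) =
    Layout.linearForest (rest (halve n S)) (rest-finite (halve n S)) (rest-∼? (halve n S))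
      pos pos-injective nothingBetween s (Fin.toℕ<n ∘ _)
    where
    open CoronaLayout (proj₂ (corona-explodeAll Fin._≟_ exploded (corona S))) D thin
    open PathDecomposition D using (s)

-- The Turing machine

pattern markStart = zero
pattern markFirst = suc markStart
pattern rowStart  = suc markFirst
pattern row       = suc rowStart
pattern diagonal  = suc row
pattern rewind    = suc diagonal
pattern shiftO    = suc rewind
pattern shiftI    = suc shiftO
pattern padO      = suc shiftI
pattern padI      = suc padO
pattern rewind′   = suc padI
pattern copy      = suc rewind′
pattern subset    = suc copy
pattern subsetPad = suc subset

State : Set
State = Fin 14

isI : Cell → Bool
isI (just I) = true
isI _        = false

cell : Bool → Cell
cell b = just (bit b)

infix 3 _emit_goto_
_emit_goto_ : (Cell × Move) × (Cell × Move) → Maybe Symbol → State → Maybe (Action 14 2)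
(i , w) emit e goto q = just (record { next = q ; writes = i ∷ w ∷ [] ; emit = e })

-- The work tape holds ♯ followed by the indicator vector of the current row u.
-- Two passes over it emit the rows of u and of its pendant vertex; the second
-- pass also moves the mark from u to its successor.

transition : State → State → Vec Cell 2 → Maybe (Action 14 2)
transition exit markStart (i ∷ w ∷ [])             = (i , stay) , (just ♯ , right) emit nothing goto markFirst
transition exit markFirst (i ∷ w ∷ [])             = (i , stay) , (just I , stay) emit nothing goto rowStart
-- Rows are never empty, so a separator at the start of a row ends the matrix. The state `exit`
-- handles what follows: `copy` for plain instances, `subset` for restricted ones.
transition exit rowStart  (just ♯ ∷ w ∷ [])        = (just ♯ , right) , (w , stay) emit just ♯ goto exit
transition exit rowStart  (i ∷ w ∷ [])             = (i , stay) , (w , stay) emit nothing goto row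
transition exit row       (just ♯ ∷ w ∷ [])        = (just ♯ , right) , (w , left) emit just ♯ goto rewind
transition exit row       (just x ∷ w ∷ [])        = (just x , stay) , (w , stay) emit just x goto diagonal
-- The mark tells whether the column belongs to the pendant of the current vertex. Rewriting it
-- turns the blanks of the very first row into `O`.
transition exit diagonal  (i ∷ w ∷ [])             = (i , right) , (cell (isI w) , right) emit just (bit (isI w)) goto row
transition exit rewind    (i ∷ just ♯ ∷ [])        = (i , stay) , (just ♯ , right) emit nothing goto shiftO
transition exit rewind    (i ∷ w ∷ [])             = (i , stay) , (w , left) emit nothing goto rewind
-- The letter in the state is the mark read one cell earlier, initially `O`. It overwrites the
-- current mark, which is emitted and remembered in turn.
transition exit shiftO    (i ∷ just O ∷ [])        = (i , stay) , (just O , right) emit just O goto padO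
transition exit shiftO    (i ∷ just I ∷ [])        = (i , stay) , (just O , right) emit just I goto padI
transition exit shiftO    (i ∷ w ∷ [])             = (i , stay) , (w , left) emit just ♯ goto rewind′
transition exit shiftI    (i ∷ just O ∷ [])        = (i , stay) , (just I , right) emit just O goto padO
transition exit shiftI    (i ∷ just I ∷ [])        = (i , stay) , (just I , right) emit just I goto padI
transition exit shiftI    (i ∷ w ∷ [])             = (i , stay) , (w , left) emit just ♯ goto rewind′
transition exit padO      (i ∷ w ∷ [])             = (i , stay) , (w , stay) emit just O goto shiftO
transition exit padI      (i ∷ w ∷ [])             = (i , stay) , (w , stay) emit just O goto shiftI
transition exit rewind′   (i ∷ just ♯ ∷ [])        = (i , stay) , (just ♯ , right) emit nothing goto rowStart
transition exit rewind′   (i ∷ w ∷ [])             = (i , stay) , (w , left) emit nothing goto rewind′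
transition exit copy      (just x ∷ w ∷ [])        = (just x , right) , (w , stay) emit just x goto copy
transition exit subset    (just ♯ ∷ w ∷ [])        = (just ♯ , right) , (w , stay) emit just ♯ goto copy
transition exit subset    (just x ∷ w ∷ [])        = (just x , stay) , (w , stay) emit just x goto subsetPad
transition exit subsetPad (i ∷ w ∷ [])             = (i , right) , (w , stay) emit just O goto subset
transition exit _         _                        = nothing

machine : State → Machine
machine exit = record { states = 14 ; start = markStart ; workTapes = 1 ; δ = transition exit }

-- Tape contents and the intended output

current : List Cell → Cell
current []      = nothing
current (c ∷ _) = c

at : List Cell → List Cell → Tape
at ls cs = tape ls (current cs) (drop 1 cs)

input : List Cell → List Symbol → Tape
input ls xs = at ls (map just xs)

leftOf : List Cell → List Cell → Tape
leftOf []       cs = tape [] nothing cs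
leftOf (l ∷ ls) cs = tape ls l cs

load-input : ∀ xs → load xs ≡ input [] xs
load-input []       = refl
load-input (x ∷ xs) = refl

write-right : ∀ c ls cs → writeMove (c , right) (at ls cs) ≡ at (c ∷ ls) (drop 1 cs)
write-right c ls []            = refl
write-right c ls (_ ∷ [])      = refl
write-right c ls (_ ∷ _ ∷ cs)  = refl

write-left : ∀ c d ls cs → writeMove (c , left) (tape ls d cs) ≡ leftOf ls (c ∷ cs)
write-left c d []       cs = refl
write-left c d (_ ∷ ls) cs = refl

write-stay : ∀ t → writeMove (head t , stay) t ≡ t
write-stay (tape _ _ _) = refl

interleave : List Bool → List Bool → List Symbol
interleave (x ∷ xs) (y ∷ ys) = bit x ∷ bit y ∷ interleave xs ys
interleave _        _        = []

spread : List Bool → List Symbol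
spread xs = interleave xs (map (λ _ → false) xs)

shift : Bool → List Bool → List Bool
shift b []       = []
shift b (x ∷ xs) = b ∷ shift x xs

-- What the first pass of length n reads on the work tape: on the very first
-- row the tape is still blank beyond the mark.

marks : ℕ → List Cell → List Bool
marks zero    cs = []
marks (suc n) cs = isI (current cs) ∷ marks n (drop 1 cs)

beyond : ℕ → List Cell → List Cell
beyond zero    cs = cs
beyond (suc n) cs = beyond n (drop 1 cs)

encodeRows : List (List Bool) → List Symbol → List Symbol
encodeRows []       tail = ♯ ∷ tail
encodeRows (r ∷ rs) tail = map bit r ++ ♯ ∷ encodeRows rs tail

-- With `e` the indicator of the current vertex u, `interleave r e` is the row of u and `spread e`
-- the row of its pendant.
pendantRows : List (List Bool) → List Bool → List Symbol → List Symbol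
pendantRows []       e tail = ♯ ∷ tail
pendantRows (r ∷ rs) e tail = interleave r e ++ ♯ ∷ spread e ++ ♯ ∷ pendantRows rs (shift false e) tail

length-shift : ∀ b xs → length (shift b xs) ≡ length xs
length-shift b []       = refl
length-shift b (x ∷ xs) = cong suc (length-shift x xs)

length-marks : ∀ n cs → length (marks n cs) ≡ n
length-marks zero    cs = refl
length-marks (suc n) cs = cong suc (length-marks n (drop 1 cs))

isI-cell : ∀ b → isI (cell b) ≡ b
isI-cell false = refl
isI-cell true  = refl

marks-cells : ∀ xs cs → marks (length xs) (map cell xs ++ cs) ≡ xs
marks-cells []       cs = refl
marks-cells (x ∷ xs) cs = cong₂ _∷_ (isI-cell x) (marks-cells xs cs)

beyond-cells : ∀ xs cs → beyond (length xs) (map cell xs ++ cs) ≡ cs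
beyond-cells []       cs = refl
beyond-cells (x ∷ xs) cs = beyond-cells xs cs

reverse-cells : ∀ xs cs → map cell (reverse xs) ++ cs ≡ map cell xs ʳ++ cs
reverse-cells xs cs = trans (cong (_++ cs) (reverse-map cell xs)) (sym (ʳ++-defn (map cell xs)))

-- Correctness and running time of the machine

module Run (exit : State) where

  open Machine (machine exit)

  Runs : Config → ℕ → List Symbol → Set
  Runs c B w = ∃[ t ] t ≤ B × c ⇓⟨ t ⟩ w

  weaken : ∀ {c B B′ w} → B ≤ B′ → Runs c B w → Runs c B′ w
  weaken B≤B′ (t , t≤B , r) = t , ≤-trans t≤B B≤B′ , r

  step′ : ∀ {q ts a B w} → δ q (Vec.map head ts) ≡ just a →
          Runs (Action.next a , zipWith writeMove (Action.writes a) ts) B w →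
          Runs (q , ts) (suc B) (fromMaybe (Action.emit a) ++ w)
  step′ eq (t , t≤B , r) = suc t , s≤s t≤B , move eq r

  retape : ∀ {q t u t′ u′ B w} → t′ ≡ t → u′ ≡ u → Runs (q , t ∷ u ∷ []) B w → Runs (q , t′ ∷ u′ ∷ []) B w
  retape refl refl r = r

  runs-copy : ∀ xs {ls u} → Runs (copy , input ls xs ∷ u ∷ []) (length xs) xs
  runs-copy []       = 0 , z≤n , halt refl
  runs-copy (x ∷ xs) {ls} {u} = step′ refl
    (retape (write-right (just x) ls (map just (x ∷ xs))) (write-stay u) (runs-copy xs))

  -- `transition` reduces only once the scanned bit is known; this and the similar equations below
  -- make that case distinction.
  δ-subset : ∀ x w → δ subset (cell x ∷ w ∷ []) ≡ ((cell x , stay) , (w , stay) emit just (bit x) goto subsetPad)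
  δ-subset false w = refl
  δ-subset true  w = refl

  δ-rowStart : ∀ x w → δ rowStart (cell x ∷ w ∷ []) ≡ ((cell x , stay) , (w , stay) emit nothing goto row)
  δ-rowStart false w = refl
  δ-rowStart true  w = refl

  δ-row : ∀ x w → δ row (cell x ∷ w ∷ []) ≡ ((cell x , stay) , (w , stay) emit just (bit x) goto diagonal)
  δ-row false w = refl
  δ-row true  w = refl

  δ-rewind : ∀ x i → δ rewind (i ∷ cell x ∷ []) ≡ ((i , stay) , (cell x , left) emit nothing goto rewind)
  δ-rewind false i = refl
  δ-rewind true  i = refl

  δ-rewind′ : ∀ x i → δ rewind′ (i ∷ cell x ∷ []) ≡ ((i , stay) , (cell x , left) emit nothing goto rewind′)
  δ-rewind′ false i = refl
  δ-rewind′ true  i = refl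

  shifting padding : Bool → State
  shifting false = shiftO
  shifting true  = shiftI
  padding false = padO
  padding true  = padI

  δ-shift : ∀ b x i → δ (shifting b) (i ∷ cell x ∷ []) ≡
            ((i , stay) , (cell b , right) emit just (bit x) goto padding x)
  δ-shift false false i = refl
  δ-shift false true  i = refl
  δ-shift true  false i = refl
  δ-shift true  true  i = refl

  δ-shiftEnd : ∀ b i → δ (shifting b) (i ∷ nothing ∷ []) ≡
               ((i , stay) , (nothing , left) emit just ♯ goto rewind′)
  δ-shiftEnd false i = refl
  δ-shiftEnd true  i = refl

  δ-pad : ∀ b i w → δ (padding b) (i ∷ w ∷ []) ≡ ((i , stay) , (w , stay) emit just O goto shifting b)
  δ-pad false i w = refl
  δ-pad true  i w = refl

  runs-subset : ∀ xs tail {ls u} → Runs (subset , input ls (map bit xs ++ ♯ ∷ tail) ∷ u ∷ [])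
                (length xs * 2 + suc (length tail)) (spread xs ++ ♯ ∷ tail)
  runs-subset [] tail {ls} {u} = step′ refl
    (retape (write-right (just ♯) ls (map just (♯ ∷ tail))) (write-stay u) (runs-copy tail))
  runs-subset (x ∷ xs) tail {ls} {u} = step′ (δ-subset x (head u))
    (retape refl (write-stay u) (step′ refl
    (retape (write-right (cell x) ls (map just (map bit (x ∷ xs) ++ ♯ ∷ tail))) (write-stay u)
    (runs-subset xs tail))))

  -- The rest of the run is passed as a continuation, so outputs and step bounds accumulate. It must
  -- work for every `ls`, because input cells to the left of the head are never visited again.
  runs-row : ∀ r cs {xs ls ms B w} →
             (∀ {ls} → Runs (row , input ls (♯ ∷ xs) ∷
                             at (map cell (marks (length r) cs) ʳ++ ms) (beyond (length r) cs) ∷ []) B w) →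
             Runs (row , input ls (map bit r ++ ♯ ∷ xs) ∷ at ms cs ∷ []) (length r * 2 + B)
                  (interleave r (marks (length r) cs) ++ w)
  runs-row [] cs k = k
  runs-row (x ∷ r) cs {xs} {ls} {ms} k = step′ (δ-row x (current cs)) (step′ refl
    (retape (write-right (cell x) ls (map just (map bit (x ∷ r) ++ ♯ ∷ xs))) (write-right _ ms cs)
    (runs-row r (drop 1 cs) k)))

  runs-rewind : ∀ xs {t cs B w} →
                Runs (shiftO , t ∷ at (just ♯ ∷ []) (map cell xs ʳ++ cs) ∷ []) B w →
                Runs (rewind , t ∷ leftOf (map cell xs ++ just ♯ ∷ []) cs ∷ []) (suc (length xs) + B) w
  runs-rewind [] {t} {cs} k = step′ refl (retape (write-stay t) (write-right (just ♯) [] (just ♯ ∷ cs)) k)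
  runs-rewind (x ∷ xs) {t} {cs} k = step′ (δ-rewind x (head t))
    (retape (write-stay t) (write-left (cell x) (cell x) (map cell xs ++ just ♯ ∷ []) cs) (runs-rewind xs k))

  runs-rewind′ : ∀ xs {t cs B w} →
                 Runs (rowStart , t ∷ at (just ♯ ∷ []) (map cell xs ʳ++ cs) ∷ []) B w →
                 Runs (rewind′ , t ∷ leftOf (map cell xs ++ just ♯ ∷ []) cs ∷ []) (suc (length xs) + B) w
  runs-rewind′ [] {t} {cs} k = step′ refl (retape (write-stay t) (write-right (just ♯) [] (just ♯ ∷ cs)) k)
  runs-rewind′ (x ∷ xs) {t} {cs} k = step′ (δ-rewind′ x (head t))
    (retape (write-stay t) (write-left (cell x) (cell x) (map cell xs ++ just ♯ ∷ []) cs) (runs-rewind′ xs k))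

  -- The rewinding states see the cells left of the head in reverse order.

  backwards : ∀ xs cs → leftOf (map cell xs ʳ++ just ♯ ∷ []) cs ≡ leftOf (map cell (reverse xs) ++ just ♯ ∷ []) cs
  backwards xs cs = cong (λ ls → leftOf ls cs) (sym (reverse-cells xs (just ♯ ∷ [])))

  forwards : ∀ xs cs → map cell (reverse xs) ʳ++ cs ≡ map cell xs ++ cs
  forwards xs cs = trans (sym (reverse-cells (reverse xs) cs)) (cong (λ ys → map cell ys ++ cs) (reverse-involutive xs))

  -- The continuation accepts either remembered bit `c`: the last mark falls off the end of the
  -- vector.
  runs-shift : ∀ b xs {t ms B w} →
               (∀ {c} → Runs (shifting c , t ∷ tape (map cell (shift b xs) ʳ++ ms) nothing [] ∷ []) B w) →
               Runs (shifting b , t ∷ at ms (map cell xs ++ nothing ∷ []) ∷ []) (length xs * 2 + B) (spread xs ++ w)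
  runs-shift b [] k = k {b}
  runs-shift b (x ∷ xs) {t} {ms} k = step′ (δ-shift b x (head t))
    (retape (write-stay t) (write-right (cell b) ms (map cell (x ∷ xs) ++ nothing ∷ []))
    (step′ (δ-pad x (head t) _)
    (retape (write-stay t) refl (runs-shift x xs λ {c} → k {c}))))

  -- The tape beyond the vector is blank in two list forms: no cell at all on the first row, and the
  -- explicit blank left behind by the shifting pass on later rows.
  Blank : ℕ → List Cell → Set
  Blank n cs = beyond n cs ≡ [] ⊎ beyond n cs ≡ nothing ∷ []

  padded : List Cell → List Cell
  padded cs = current cs ∷ drop 1 cs

  blank-padded : ∀ {n cs} → Blank n cs → padded (beyond n cs) ≡ nothing ∷ []
  blank-padded (inj₁ eq) = cong padded eq
  blank-padded (inj₂ eq) = cong padded eq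

  -- This is the origin of the constant 6: two passes with two steps per column and two rewinds with
  -- one. The five remaining steps are paid for by the separator of the row.
  rowCost : ∀ {n a b c d} L → a ≡ n → b ≡ n → c ≡ n → d ≡ n + suc L →
            suc (n * 2 + suc (suc a + (b * 2 + suc (suc c + 6 * L)))) ≤ 6 * d
  rowCost {n} L refl refl refl refl = ≤-trans (n≤1+n _) (≤-reflexive (solve n L))
    where
    solve : ∀ n L → 1 + (1 + (n * 2 + (1 + (1 + n + (n * 2 + (1 + (1 + n + 6 * L))))))) ≡ 6 * (n + (1 + L))
    solve = solve-∀

  runs-rows : ∀ m rs {cs xs w ls} → All (λ r → length r ≡ suc m) rs → Blank (suc m) cs →
              (∀ {ls u} → Runs (exit , input ls xs ∷ u ∷ []) (6 * length xs) w) →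
              Runs (rowStart , input ls (encodeRows rs xs) ∷ at (just ♯ ∷ []) cs ∷ [])
                   (6 * length (encodeRows rs xs)) (pendantRows rs (marks (suc m) cs) w)
  runs-rows m [] {xs = xs} {ls = ls} _ _ k =
    weaken (≤-trans (+-monoˡ-≤ (6 * length xs) (s≤s (z≤n {5}))) (≤-reflexive (sym (*-suc 6 (length xs)))))
      (step′ refl (retape (write-right (just ♯) ls (map just (♯ ∷ xs))) refl k))
  runs-rows m ((x ∷ r) ∷ rs) {cs} {xs} {w} {ls} (refl ∷ lengths) blank k =
    weaken bound
      (step′ (δ-rowStart x (current cs))
      (runs-row (x ∷ r) cs λ {ls} →
        step′ refl
        (retape (write-right (just ♯) ls (map just (♯ ∷ E)))
                (trans (write-left _ _ (map cell e ʳ++ just ♯ ∷ []) _)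
                (trans (cong (leftOf _) (blank-padded {suc m} {cs} blank)) (backwards e _)))
        (runs-rewind (reverse e)
        (retape refl (cong (at _) (forwards e _))
        (runs-shift false e λ {c} →
          step′ (δ-shiftEnd c _)
          (retape (write-stay _) (trans (write-left nothing nothing (map cell e′ ʳ++ just ♯ ∷ []) []) (backwards e′ _))
          (runs-rewind′ (reverse e′)
          (retape refl (cong (at _) (forwards e′ _))
          -- The recursive call speaks of the marks read back from the tape, which are the shifted
          -- vector.
          (subst (λ e → Runs (rowStart , input (just ♯ ∷ ls) E ∷ at (just ♯ ∷ []) cells-e′ ∷ [])
                             (6 * length E) (pendantRows rs e w)) marks-e′
          (runs-rows m rs {cells-e′} {xs} lengths (inj₂ blank-e′) k)))))))))))
    where
    E = encodeRows rs xs
    e = marks (suc m) cs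
    e′ = shift false e
    length-e′ : length e′ ≡ suc m
    length-e′ = trans (length-shift false e) (length-marks (suc m) cs)
    cells-e′ = map cell e′ ++ nothing ∷ []
    marks-e′ : marks (suc m) cells-e′ ≡ e′
    marks-e′ = subst (λ n → marks n cells-e′ ≡ e′) length-e′ (marks-cells e′ (nothing ∷ []))
    blank-e′ : beyond (suc m) cells-e′ ≡ nothing ∷ []
    blank-e′ = subst (λ n → beyond n cells-e′ ≡ nothing ∷ []) length-e′ (beyond-cells e′ (nothing ∷ []))
    bound : suc (suc m * 2 + suc (suc (length (reverse e)) +
              (length e * 2 + suc (suc (length (reverse e′)) + 6 * length E)))) ≤
            6 * length (map bit (x ∷ r) ++ ♯ ∷ E)
    bound = rowCost (length E) (trans (length-reverse e) (length-marks (suc m) cs)) (length-marks (suc m) cs)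
      (trans (length-reverse e′) length-e′)
      (trans (length-++ (map bit (x ∷ r))) (cong (_+ suc (length E)) (length-map bit (x ∷ r))))

  -- Two steps set up the work tape with ♯ and the mark of the first vertex; the successor in the
  -- time bound pays for them.
  runs-machine : ∀ m rs {xs w} → All (λ r → length r ≡ suc m) rs →
                 (∀ {ls u} → Runs (exit , input ls xs ∷ u ∷ []) (6 * length xs) w) →
                 Runs (initial (encodeRows rs xs)) (6 * suc (length (encodeRows rs xs)) ^ 1)
                      (pendantRows rs (marks (suc m) (just I ∷ [])) w)
  runs-machine m rs {xs} lengths k = weaken bound
    (retape (load-input (encodeRows rs xs)) refl
    (step′ refl (step′ refl (runs-rows m rs {just I ∷ []} {xs} lengths (inj₁ (beyond-[] m)) k))))
    where
    beyond-[] : ∀ n → beyond n [] ≡ []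
    beyond-[] zero    = refl
    beyond-[] (suc n) = beyond-[] n
    L = length (encodeRows rs xs)
    bound : 2 + 6 * L ≤ 6 * suc L ^ 1
    bound = ≤-trans (+-monoˡ-≤ (6 * L) (s≤s (s≤s (z≤n {4}))))
              (≤-reflexive (trans (sym (*-suc 6 L)) (cong (6 *_) (sym (*-identityʳ (suc L))))))

-- Encodings

adjacencyMatrix : ∀ {m n} → (Fin m → Fin n → Bool) → List (List Bool)
adjacencyMatrix g = tabulate λ u → tabulate (g u)

encodeRows-tabulate : ∀ {m n} (g : Fin m → Fin n → Bool) tail →
  concat (tabulate λ u → tabulate (λ v → bit (g u v)) ++ [ ♯ ]) ++ ♯ ∷ tail ≡ encodeRows (adjacencyMatrix g) tail
encodeRows-tabulate {zero}  g tail = refl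
encodeRows-tabulate {suc m} g tail = begin
  ((r ++ [ ♯ ]) ++ rest) ++ ♯ ∷ tail  ≡⟨ ++-assoc (r ++ [ ♯ ]) rest _ ⟩
  (r ++ [ ♯ ]) ++ (rest ++ ♯ ∷ tail)  ≡⟨ ++-assoc r [ ♯ ] _ ⟩
  r ++ ♯ ∷ (rest ++ ♯ ∷ tail)
    ≡⟨ cong₂ (λ r s → r ++ ♯ ∷ s) (sym (map-tabulate (g zero) bit)) (encodeRows-tabulate (g ∘ suc) tail) ⟩
  encodeRows (adjacencyMatrix g) tail ∎
  where
  open ≡-Reasoning
  r = tabulate (λ v → bit (g zero v))
  rest = concat (tabulate λ u → tabulate (λ v → bit (g (suc u) v)) ++ [ ♯ ])

indicator : ∀ n → ℕ → List Bool
indicator n k = tabulate {n = n} λ v → k ≡ᵇ toℕ v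

shift-tabulate : ∀ n (f : ℕ → Bool) →
  shift (f 0) (tabulate {n = n} λ v → f (suc (toℕ v))) ≡ tabulate {n = n} λ v → f (toℕ v)
shift-tabulate zero    f = refl
shift-tabulate (suc n) f = cong (f 0 ∷_) (shift-tabulate n (f ∘ suc))

shift-indicator : ∀ n k → shift false (indicator n k) ≡ indicator n (suc k)
shift-indicator n k = shift-tabulate n (suc k ≡ᵇ_)

marks-first : ∀ m → marks (suc m) (just I ∷ []) ≡ indicator (suc m) 0
marks-first m = cong (true ∷_) (marks-[] m)
  where
  marks-[] : ∀ n → marks n [] ≡ tabulate {n = n} λ _ → false
  marks-[] zero    = refl
  marks-[] (suc n) = cong (false ∷_) (marks-[] n)

tabulate-remQuot : ∀ n (f : Fin n × Fin 2 → Bool) →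
  tabulate {n = n * 2} (λ i → bit (f (remQuot 2 i))) ≡
  interleave (tabulate λ v → f (v , zero)) (tabulate λ v → f (v , suc zero))
tabulate-remQuot zero    f = refl
tabulate-remQuot (suc n) f =
  cong (λ xs → bit (f (zero , zero)) ∷ bit (f (zero , suc zero)) ∷ xs) (tabulate-remQuot n (f ∘ Product.map₁ suc))

-- The induction removes rows but keeps all `n` columns, so the remaining rows start at an offset
-- `k`. They are given by an arbitrary `h`, which can be restricted to the later indices.
pendantRows-tabulate : ∀ {m n} k (g : Fin m → Fin n → Bool) (h : Fin (m * 2) → List Symbol) tail →
  (∀ (u : Fin m) → h (main u) ≡ interleave (tabulate (g u)) (indicator n (k + toℕ u)) ++ [ ♯ ]) →
  (∀ (u : Fin m) → h (pend u) ≡ spread (indicator n (k + toℕ u)) ++ [ ♯ ]) →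
  concat (tabulate h) ++ ♯ ∷ tail ≡ pendantRows (adjacencyMatrix g) (indicator n k) tail
pendantRows-tabulate {zero} k g h tail _ _ = refl
pendantRows-tabulate {suc m} {n} k g h tail h-main h-pend = begin
  (h zero ++ (h (suc zero) ++ rest)) ++ ♯ ∷ tail ≡⟨ ++-assoc (h zero) _ _ ⟩
  h zero ++ ((h (suc zero) ++ rest) ++ ♯ ∷ tail) ≡⟨ cong (h zero ++_) (++-assoc (h (suc zero)) _ _) ⟩
  h zero ++ (h (suc zero) ++ (rest ++ ♯ ∷ tail))
    ≡⟨ cong₂ (λ x y → x ++ (y ++ (rest ++ ♯ ∷ tail))) (h-main zero) (h-pend zero) ⟩
  (interleave r (indicator n (k + 0)) ++ [ ♯ ]) ++ ((spread (indicator n (k + 0)) ++ [ ♯ ]) ++ (rest ++ ♯ ∷ tail))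
    ≡⟨ cong (λ j → (interleave r (indicator n j) ++ [ ♯ ]) ++
                   ((spread (indicator n j) ++ [ ♯ ]) ++ (rest ++ ♯ ∷ tail))) (+-identityʳ k) ⟩
  (interleave r e ++ [ ♯ ]) ++ ((spread e ++ [ ♯ ]) ++ (rest ++ ♯ ∷ tail))
    ≡⟨ cong (λ xs → (interleave r e ++ [ ♯ ]) ++ ((spread e ++ [ ♯ ]) ++ xs)) IH ⟩
  (interleave r e ++ [ ♯ ]) ++ ((spread e ++ [ ♯ ]) ++ next)
    ≡⟨ ++-assoc (interleave r e) _ _ ⟩
  interleave r e ++ ♯ ∷ ((spread e ++ [ ♯ ]) ++ next)
    ≡⟨ cong (λ xs → interleave r e ++ ♯ ∷ xs) (++-assoc (spread e) _ _) ⟩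
  interleave r e ++ ♯ ∷ spread e ++ ♯ ∷ next ∎
  where
  open ≡-Reasoning
  r = tabulate (g zero)
  e = indicator n k
  rest = concat (tabulate λ i → h (suc (suc i)))
  next = pendantRows (adjacencyMatrix (g ∘ suc)) (shift false e) tail
  IH : rest ++ ♯ ∷ tail ≡ next
  IH = trans
    (pendantRows-tabulate (suc k) (g ∘ suc) (λ i → h (suc (suc i))) tail
      (λ u → trans (h-main (suc u))
        (cong (λ j → interleave (tabulate (g (suc u))) (indicator n j) ++ [ ♯ ]) (+-suc k (toℕ u))))
      (λ u → trans (h-pend (suc u))
        (cong (λ j → spread (indicator n j) ++ [ ♯ ]) (+-suc k (toℕ u)))))
    (cong (λ e → pendantRows (adjacencyMatrix (g ∘ suc)) e tail) (sym (shift-indicator n k)))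

does-≟ : ∀ {n} (u v : Fin n) → does (u Fin.≟ v) ≡ (toℕ u ≡ᵇ toℕ v)
does-≟ zero    zero    = refl
does-≟ zero    (suc v) = refl
does-≟ (suc u) zero    = refl
does-≟ (suc u) (suc v) = does-≟ u v

module _ (G : FiniteGraph) where

  open FiniteGraph G renaming (order to n)
  open Pendants G

  matrix : List (List Bool)
  matrix = adjacencyMatrix λ u v → does (u ∼? v)

  encodeGraph-rows : ∀ tail → encodeGraph G ++ ♯ ∷ tail ≡ encodeRows matrix tail
  encodeGraph-rows = encodeRows-tabulate λ u v → does (u ∼? v)

  private
    rowOf : Fin n × Fin 2 → List Symbol
    rowOf x = tabulate (λ j → bit (does (pendantAdjacent? x (remQuot {n} 2 j)))) ++ [ ♯ ]

    row-main : ∀ u → rowOf (u , zero) ≡ interleave (tabulate λ v → does (u ∼? v)) (indicator n (toℕ u)) ++ [ ♯ ]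
    row-main u = cong (_++ [ ♯ ]) (trans
      (tabulate-remQuot n (does ∘ pendantAdjacent? (u , zero)))
      (cong (interleave (tabulate λ v → does (u ∼? v))) (tabulate-cong (does-≟ u))))

    row-pend : ∀ u → rowOf (u , suc zero) ≡ spread (indicator n (toℕ u)) ++ [ ♯ ]
    row-pend u = cong (_++ [ ♯ ]) (trans
      (tabulate-remQuot n (does ∘ pendantAdjacent? (u , suc zero)))
      (cong₂ interleave (tabulate-cong (does-≟ u)) (sym (map-tabulate {n = n} _ (λ _ → false)))))

  encodeGraph-pendantRows : ∀ tail →
    encodeGraph withPendants ++ ♯ ∷ tail ≡ pendantRows matrix (indicator n 0) tail
  encodeGraph-pendantRows tail = pendantRows-tabulate 0 (λ u v → does (u ∼? v)) (rowOf ∘ remQuot {n} 2) tail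
    (λ u → trans (cong rowOf (Fin.remQuot-combine u zero)) (row-main u))
    (λ u → trans (cong rowOf (Fin.remQuot-combine u (suc zero))) (row-pend u))

module Reduction (exit : State) where

  open Machine (machine exit)
  open Run exit

  runs-matrix : ∀ n (g : Fin n → Fin n → Bool) {xs w} →
    (∀ {ls u} → Runs (exit , input ls xs ∷ u ∷ []) (6 * length xs) w) →
    Runs (initial (encodeRows (adjacencyMatrix g) xs)) (6 * suc (length (encodeRows (adjacencyMatrix g) xs)) ^ 1)
         (pendantRows (adjacencyMatrix g) (indicator n 0) w)
  -- There are no rows, so any positive row length can be claimed.
  runs-matrix zero g k = runs-machine 0 [] [] k
  runs-matrix (suc m) g {xs} {w} k = subst
    (λ e → Runs (initial input-word) (6 * suc (length input-word) ^ 1) (pendantRows (adjacencyMatrix g) e w))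
    (marks-first m)
    (runs-machine m (adjacencyMatrix g) {xs} (All.tabulate⁺ {f = λ u → tabulate (g u)} (λ u → length-tabulate (g u))) k)
    where input-word = encodeRows (adjacencyMatrix g) xs

  runs-graph : ∀ G {xs w} →
    (∀ {ls u} → Runs (exit , input ls xs ∷ u ∷ []) (6 * length xs) w) →
    Runs (initial (encodeGraph G ++ ♯ ∷ xs)) (6 * suc (length (encodeGraph G ++ ♯ ∷ xs)) ^ 1)
         (encodeGraph (Pendants.withPendants G) ++ ♯ ∷ w)
  runs-graph G {xs} {w} k = subst₂ (λ x y → Runs (initial x) (6 * suc (length x) ^ 1) y)
    (sym (encodeGraph-rows G xs)) (sym (encodeGraph-pendantRows G w)) (runs-matrix order (λ u v → does (u ∼? v)) {xs} k)
    where open FiniteGraph G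

-- The two reductions

encodeSubset-double : ∀ {n} (X : Subset n) → encodeSubset (double X) ≡ spread (toList X)
encodeSubset-double []      = refl
encodeSubset-double (x ∷ X) = cong (λ xs → bit x ∷ O ∷ xs) (encodeSubset-double X)

reduction : ParameterPreservingReduction CPP POVE
reduction = record
  { f              = λ x → let open PlainInstance x in record { G = Pendants.withPendants G ; k = k }
  ; polynomialTime = machine copy , 6 , 1 , λ x → let open PlainInstance x in
      runs-graph G (weaken (m≤m+n (length (encodeℕ k)) _) (runs-copy (encodeℕ k)))
  ; parameter-≤    = λ _ → ≤-refl
  ; correct        = λ x → let open PlainInstance x in let open Pendants G in mk⇔
      (λ (lift (S , ∣S∣≤k , linear)) →
        double S , ≤-trans (≤-reflexive (∣double∣ S)) ∣S∣≤k , deletion⇒explosion S linear)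
      (λ (S , ∣S∣≤k , thin) →
        lift (halve order S , ≤-trans (∣halve∣≤ {order} S) ∣S∣≤k , explosion⇒deletion S thin))
  }
  where
  open Run copy
  open Reduction copy

restrictedReduction : ParameterPreservingReduction RestrictedCPP RestrictedPOVE
restrictedReduction = record
  { f              = λ x → let open RestrictedInstance x in record { G = Pendants.withPendants G ; X = double X ; k = k }
  ; polynomialTime = machine subset , 6 , 1 , λ x → let open RestrictedInstance x in
      runs-graph G (tail-runs X (encodeℕ k))
  ; parameter-≤    = λ _ → ≤-refl
  ; correct        = λ x → let open RestrictedInstance x in let open Pendants G in mk⇔
      (λ (lift (S , S⊆X , ∣S∣≤k , linear)) →
        double S , double-⊆ S⊆X , ≤-trans (≤-reflexive (∣double∣ S)) ∣S∣≤k , deletion⇒explosion S linear)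
      (λ (S , S⊆X , ∣S∣≤k , thin) →
        lift (halve order S , halve-⊆ S⊆X , ≤-trans (∣halve∣≤ {order} S) ∣S∣≤k , explosion⇒deletion S thin))
  }
  where
  open Run subset
  open Reduction subset

  tail-runs : ∀ {n} (X : Subset n) tail {ls u} →
    Runs (subset , input ls (encodeSubset X ++ ♯ ∷ tail) ∷ u ∷ []) (6 * length (encodeSubset X ++ ♯ ∷ tail))
         (encodeSubset (double X) ++ ♯ ∷ tail)
  tail-runs X tail rewrite encodeSubset-double X = weaken bound (runs-subset (toList X) tail)
    where
    a = length (toList X)
    b = suc (length tail)
    open ≤-Reasoning
    bound : a * 2 + b ≤ 6 * length (encodeSubset X ++ ♯ ∷ tail)
    bound = begin
      a * 2 + b             ≡⟨ cong (_+ b) (*-comm a 2) ⟩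
      2 * a + b             ≤⟨ +-mono-≤ (*-monoˡ-≤ a {2} {6} (s≤s (s≤s z≤n))) (m≤m+n b (5 * b)) ⟩
      6 * a + 6 * b         ≡⟨ *-distribˡ-+ 6 a b ⟨
      6 * (a + b)           ≡⟨ cong (λ c → 6 * (c + b)) (length-map bit (toList X)) ⟨
      6 * (length (encodeSubset X) + b) ≡⟨ cong (6 *_) (length-++ (encodeSubset X)) ⟨
      6 * length (encodeSubset X ++ ♯ ∷ tail) ∎

lemma5 : ParameterPreservingReduction CPP POVE × ParameterPreservingReduction RestrictedCPP RestrictedPOVE
lemma5 = reduction , restrictedReduction
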